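{- Let $p>3$ be a prime. Then $$\sum_{n=0}^{(p-1)/2}\frac{6n+1}{(-512)^n}\binom{2n}{n}^3\equiv p\left(\frac{ -2}{p}\right)+\frac{p^3}{4}\left(\frac{2}{p}\right)E_{p-3}\pmod{p^4}.$$
   Context: $\left(\frac{\cdot}{p}\right)$ denotes the Legendre symbol. The Euler numbers $E_n$ are defined by $\frac{2e^t}{e^{2t}+1}=\sum_{n\ge 0}E_n\frac{t^n}{n!}$ ($|t|<\pi/2$). Congruences between rational numbers whose denominators are coprime to $p$ are understood in the ring of rationals with denominator prime to $p$. -}

module Defs where

open import Data.Nat as ℕ using (ℕ; zero; suc; ⌊_/2⌋; _≡ᵇ_)
open import Data.Nat.Properties using (m^n≢0)
open import Data.Nat.Combinatorics using (_C_)
open import Data.Nat.Divisibility using (_∣_)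
open import Data.Bool using (Bool; true; false; if_then_else_)
open import Data.Integer as ℤ using (ℤ; +_; -[1+_])
open import Data.List using (List; []; _∷_; upTo)
open import Data.Bool.ListAction using (any)
open import Data.Rational as ℚ using (ℚ; _/_)
open import Data.Product using (∃₂; _×_)
open import Relation.Nullary using (¬_)
open import Relation.Binary.PropositionalEquality using (_≡_)

sumTo : ℕ → (ℕ → ℚ) → ℚ
sumTo zero    f = f 0
sumTo (suc N) f = sumTo N f ℚ.+ f (suc N)

ι : ℤ → ℚ
ι z = z / 1

legendre : ℤ → ℕ → ℤ
legendre a zero = + 0
legendre a (suc q) with ℤ._%ℕ_ a (suc q)
... | zero = + 0
... | r@(suc _) =
  if any (λ x → ((x ℕ.* x) ℕ.% suc q) ≡ᵇ r) (upTo (suc q)) then + 1 else -[1+ 0 ]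

-- Euler numbers, via the coefficient form of  cosh(t) · (2eᵗ/(e²ᵗ+1)) = 1 :
--   Σ_{0≤k≤n, n-k even} C(n,k) E_k = δ_{n,0}.
private
  nth : List ℤ → ℕ → ℤ
  nth []       _       = + 0
  nth (x ∷ _)  zero    = x
  nth (_ ∷ xs) (suc i) = nth xs i

  isEven : ℕ → Bool
  isEven zero = true
  isEven (suc zero) = false
  isEven (suc (suc n)) = isEven n

  sumℤ : ℕ → (ℕ → ℤ) → ℤ
  sumℤ zero    f = f 0
  sumℤ (suc N) f = sumℤ N f ℤ.+ f (suc N)

  -- eulers n = [E_n, E_{n-1}, ..., E_0]
  eulers : ℕ → List ℤ
  eulers zero = + 1 ∷ []
  eulers (suc n) = new ∷ prev
    where
    prev = eulers n
    new = ℤ.- sumℤ n (λ k → if isEven (suc n ℕ.∸ k)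
                               then + (suc n C k) ℤ.* nth prev (n ℕ.∸ k)
                               else + 0)

euler : ℕ → ℤ
euler n = nth (eulers n) 0

-- Congruence of rationals modulo m in the ring of rationals with denominator prime to p:
-- x ≡ y (mod m) iff (x - y) · v = m · u for some integer u and some natural v with p ∤ v.
Congℚ : (p : ℕ) → ℤ → ℚ → ℚ → Set
Congℚ p m x y = ∃₂ λ (u : ℤ) (v : ℕ) → ¬ (p ∣ v) × ((x ℚ.- y) ℚ.* ι (+ v) ≡ ι m ℚ.* ι u)

term : ℕ → ℚ
term n = ℚ._/_ ((-[1+ 0 ] ℤ.^ n) ℤ.* + ((6 ℕ.* n ℕ.+ 1) ℕ.* ((2 ℕ.* n) C n) ℕ.^ 3))
         (512 ℕ.^ n) {{m^n≢0 512 n}}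

lhs : ℕ → ℚ
lhs p = sumTo ⌊ p ℕ.∸ 1 /2⌋ term

rhs : ℕ → ℚ
rhs p = ι (+ p ℤ.* legendre (-[1+ 1 ]) p)
        ℚ.+ (+ (p ℕ.^ 3) ℤ.* legendre (+ 2) p ℤ.* euler (p ℕ.∸ 3)) / 4

-- Write p = 2m + 1, t = p/4, and (a)_j for the rising factorial.  A contiguous
-- relation for truncated 2F1(1) sums gives the exact identity
--   Σ_{n≤m} (6n+1) C(2n,n)³ / (-512)^n = p C(2m,m) 8^{-m} Σ_{j≤m} (-t)_j (t-m)_j / j!².
-- A second contiguous relation, now a recursion in n for Σ_{j≤n} (-t)_j (t-n)_j / j!²,
-- shows that Π_{i≤m} (1 - t/i) times the last sum is 1 + 2 t² Σ_{s≤m} (-1)^s/s²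
-- modulo p³.  On the other hand
--   C(2m,m) = (-1)^m Π (1 - 4t/i) = (-4)^m Π (1 - 2t/i),
-- and (1 - 2x)³ = (1 - x)² (1 - 4x) + O(x²) together with Σ_{i≤m} 1/i² ≡ 0 (mod p)
-- and Euler's criterion yields Π (1 - 2t/i) ≡ (2/p) 2^m Π (1 - t/i) modulo p³.
-- Finally e_k = Σ_{|s|≤m} (-1)^s (2s)^k satisfies the recurrence of (-1)^m E_k
-- modulo p because the binomial sums telescope; by Fermat, k = p - 3 gives
-- Σ_{s≤m} (-1)^s/s² ≡ 2 (-1)^m E_{p-3}.
module Submission where

open import Defs
open import Data.Bool as Bool using (true; false)
open import Data.Nat as ℕ using (ℕ; zero; suc; _∸_; z≤n; s≤s)
open import Data.Nat.Divisibility using (_∣_; divides; ∣⇒≤; m∣m*n)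
open import Data.Nat.Primality using (Prime; euclidsLemma)
open import Data.Nat.Combinatorics using (_C_; nCk≡nC[n∸k]; nCn≡1; nC1≡n; nCk+nC[k+1]≡[n+1]C[k+1]; k>n⇒nCk≡0)
import Data.Nat.Properties as ℕ
open import Data.Integer hiding (suc; NonZero)
import Data.Integer.Divisibility.Signed as Signed
open import Data.Integer.Properties
open import Data.Integer.DivMod using (n%ℕd<d; a≡a%ℕn+[a/ℕn]*n)
open import Data.Integer.Tactic.RingSolver using (solve)
import Data.Nat.Tactic.RingSolver as ℕ-Solver
open import Data.Bool.ListAction using (any)
import Data.Rational as ℚ
open import Data.Rational using (fromℚᵘ)
import Data.Rational.Properties as ℚ
open import Data.Rational.Unnormalised as ℚᵘ using (mkℚᵘ; *≡*)
import Data.Rational.Unnormalised.Properties as ℚᵘ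
open import Data.List using ([]; _∷_; upTo)
open import Data.List.Membership.Propositional using (find; lose)
open import Data.List.Membership.Propositional.Properties using (∈-upTo⁺)
open import Data.List.Relation.Unary.Any.Properties using (any⁺; any⁻)
open import Data.Product using (∃; _×_; _,_; proj₁; proj₂)
open import Data.Sum using (_⊎_; inj₁; inj₂; [_,_]′)
open import Function using (id)
open import Data.Empty using (⊥; ⊥-elim)
open import Relation.Nullary using (¬_)
open import Relation.Binary.Definitions using (tri<; tri≈; tri>)
open import Relation.Binary.PropositionalEquality

-- Congruences modulo an integer

-- The two recursions meet at one point. In the first, the parameters -(2n+1)/4 and (1-2n)/4 move
-- with n and p does not occur; at n = m they become -t and t - m. In the second, p is held fixed
-- while n runs, and the sum starts from 1 at n = 0. The exact identity carries the factor 2m+1 = p,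
-- so it alone is needed modulo p^4. What follows is modulo p^3, and since the correction carries
-- t^2, the sums of inverse squares and the Euler number matter only modulo p. Fractions are
-- replaced by integers: 1/(4i) becomes `ρ (i - 1)`, an inverse modulo p^4, and each step is a
-- polynomial identity plus multiples of known congruences. The two forms of C(2m,m) compare the
-- products of 1 - 2t/i and 1 - 4t/i, whereas the truncated sum involves 1 - t/i. The cubic identity
-- links all three, but yields only the square of the middle product; its sign is read off modulo p.

infix 4 _≈_[_]

record _≈_[_] (x y M : ℤ) : Set where
  constructor cong-by
  field
    quotient : ℤ
    equality : x - y ≡ quotient * M

≈-reflexive : ∀ {M x y} → x ≡ y → x ≈ y [ M ]
≈-reflexive {M} {x} refl = cong-by (+ 0) (solve (x ∷ M ∷ []))

≈-refl : ∀ {M x} → x ≈ x [ M ]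
≈-refl = ≈-reflexive refl

-- The lincomb lemmas derive a congruence from others by exhibiting the
-- difference of its sides as a combination of theirs.
abstract
  lincomb₁ : ∀ {M x y a b} u → a ≈ b [ M ] → x - y ≡ u * (a - b) → x ≈ y [ M ]
  lincomb₁ {M} u (cong-by k p) e =
    cong-by (u * k) (trans e (trans (cong (u *_) p) (sym (*-assoc u k M))))

  lincomb₂ : ∀ {M x y a b c d} u v → a ≈ b [ M ] → c ≈ d [ M ] →
             x - y ≡ u * (a - b) + v * (c - d) → x ≈ y [ M ]
  lincomb₂ {M} {a = a} {b} {c} {d} u v (cong-by k p) (cong-by l q) e =
    cong-by (u * k + v * l) (trans e (trans (cong₂ (λ s t → u * s + v * t) p q)
      (solve (u ∷ v ∷ k ∷ l ∷ M ∷ []))))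

  lincomb₃ : ∀ {M x y a b c d e f} u v w → a ≈ b [ M ] → c ≈ d [ M ] → e ≈ f [ M ] →
             x - y ≡ u * (a - b) + v * (c - d) + w * (e - f) → x ≈ y [ M ]
  lincomb₃ {M} {a = a} {b} {c} {d} u v w (cong-by k p) (cong-by l q) (cong-by h r) i =
    cong-by (u * k + v * l + w * h) (trans i (trans
      (cong₂ _+_ (cong₂ (λ s t → u * s + v * t) p q) (cong (w *_) r))
      (solve (u ∷ v ∷ w ∷ k ∷ l ∷ h ∷ M ∷ []))))

  lincomb₄ : ∀ {M x y a b c d e f g h} u v w z →
             a ≈ b [ M ] → c ≈ d [ M ] → e ≈ f [ M ] → g ≈ h [ M ] →
             x - y ≡ u * (a - b) + v * (c - d) + w * (e - f) + z * (g - h) → x ≈ y [ M ]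
  lincomb₄ {M} {a = a} {b} {c} {d} u v w z (cong-by k p) (cong-by l q) (cong-by m r) (cong-by n s) i =
    cong-by (u * k + v * l + w * m + z * n) (trans i (trans
      (cong₂ _+_ (cong₂ _+_ (cong₂ (λ s t → u * s + v * t) p q) (cong (w *_) r)) (cong (z *_) s))
      (solve (u ∷ v ∷ w ∷ z ∷ k ∷ l ∷ m ∷ n ∷ M ∷ []))))

≈-sym : ∀ {M x y} → x ≈ y [ M ] → y ≈ x [ M ]
≈-sym {M} {x} {y} p = lincomb₁ (- + 1) p (solve (x ∷ y ∷ []))

≈-trans : ∀ {M x y z} → x ≈ y [ M ] → y ≈ z [ M ] → x ≈ z [ M ]
≈-trans {M} {x} {y} {z} p q = lincomb₂ (+ 1) (+ 1) p q (solve (x ∷ y ∷ z ∷ []))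

≈-+ : ∀ {M x y u v} → x ≈ y [ M ] → u ≈ v [ M ] → x + u ≈ y + v [ M ]
≈-+ {M} {x} {y} {u} {v} p q = lincomb₂ (+ 1) (+ 1) p q (solve (x ∷ y ∷ u ∷ v ∷ []))

≈-* : ∀ {M x y u v} → x ≈ y [ M ] → u ≈ v [ M ] → x * u ≈ y * v [ M ]
≈-* {M} {x} {y} {u} {v} p q = lincomb₂ u y p q (solve (x ∷ y ∷ u ∷ v ∷ []))

≈-*ˡ : ∀ {M x y} u → x ≈ y [ M ] → u * x ≈ u * y [ M ]
≈-*ˡ u p = ≈-* (≈-refl {x = u}) p

≈-^ : ∀ {M x y} n → x ≈ y [ M ] → x ^ n ≈ y ^ n [ M ]
≈-^ zero    p = ≈-refl
≈-^ (suc n) p = ≈-* p (≈-^ n p)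

≈-weaken : ∀ K {M x y} → x ≈ y [ K * M ] → x ≈ y [ M ]
≈-weaken K {M} (cong-by k p) = cong-by (k * K) (trans p (sym (*-assoc k K M)))

≈-scale : ∀ {M x y} c → x ≈ y [ M ] → c * x ≈ c * y [ c * M ]
≈-scale {M} {x} {y} c (cong-by k p) = cong-by k (trans (sym dist) (trans (cong (c *_) p) (solve (c ∷ k ∷ M ∷ []))))
  where
  dist : c * (x - y) ≡ c * x - c * y
  dist = solve (c ∷ x ∷ y ∷ [])

≈-product : ∀ {M N x y u v} → x ≈ y [ M ] → u ≈ v [ N ] → (x - y) * (u - v) ≈ + 0 [ M * N ]
≈-product {M} {N} {x} {y} {u} {v} (cong-by k p) (cong-by l q) =
  cong-by (k * l) (trans (+-identityʳ _) (trans (cong₂ _*_ p q) (solve (k ∷ l ∷ M ∷ N ∷ []))))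

≈-cancel : ∀ {M x y u v} → v * u ≈ + 1 [ M ] → u * x ≈ u * y [ M ] → x ≈ y [ M ]
≈-cancel {M} {x} {y} {u} {v} p q = lincomb₂ v (y - x) q p (solve (x ∷ y ∷ u ∷ v ∷ []))

-- One step of Newton's iteration for the inverse.
inverse-lift : ∀ u v {M N} → v * u ≈ + 1 [ M ] → v * u ≈ + 1 [ N ] →
               v * (+ 2 - u * v) * u ≈ + 1 [ M * N ]
inverse-lift u v p q = lincomb₁ (- + 1) (≈-product p q) (solve (u ∷ v ∷ []))

module ≈-Reasoning (M : ℤ) where
  infix  1 begin_
  infixr 2 step-≈ step-≡
  infix  3 _∎

  begin_ : ∀ {x y} → x ≈ y [ M ] → x ≈ y [ M ]
  begin p = p

  step-≈ : ∀ x {y z} → y ≈ z [ M ] → x ≈ y [ M ] → x ≈ z [ M ]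
  step-≈ x q p = ≈-trans p q

  step-≡ : ∀ x {y z} → y ≈ z [ M ] → x ≡ y → x ≈ z [ M ]
  step-≡ x q refl = q

  syntax step-≈ x q p = x ≈⟨ p ⟩ q
  syntax step-≡ x q p = x ≡⟨ p ⟩ q

  _∎ : ∀ x → x ≈ x [ M ]
  x ∎ = ≈-refl

-- Rising factorials and central binomial coefficients

∑ : ℕ → (ℕ → ℤ) → ℤ
∑ zero    f = f 0
∑ (suc n) f = ∑ n f + f (suc n)

∑< : ℕ → (ℕ → ℤ) → ℤ
∑< zero    f = + 0
∑< (suc n) f = ∑< n f + f n

-- The step d is a parameter: step 4 clears the quarters in (a/4)_j, and a negative step gives
-- falling factorials.
poch : ℤ → ℤ → ℕ → ℤ
poch d x zero    = + 1
poch d x (suc n) = poch d x n * (x + + n * d)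

poch-suc : ∀ d x n → poch d x (suc n) ≡ x * poch d (x + d) n
poch-suc d x zero    = base
  where
  base : + 1 * (x + + 0 * d) ≡ x * + 1
  base = solve (d ∷ x ∷ [])
poch-suc d x (suc n) = trans (cong (_* (x + + suc n * d)) (poch-suc d x n))
                             (step (poch d (x + d) n) (+ n))
  where
  step : ∀ u j → x * u * (x + (+ 1 + j) * d) ≡ x * (u * (x + d + j * d))
  step u j = solve (d ∷ x ∷ u ∷ j ∷ [])

poch-cong : ∀ {M} d {x y} n → x ≈ y [ M ] → poch d x n ≈ poch d y n [ M ]
poch-cong d zero    p = ≈-refl
poch-cong d (suc n) p = ≈-* (poch-cong d n p) (≈-+ p ≈-refl)

absorption : ∀ n k → suc k ℕ.* (suc n C suc k) ≡ suc n ℕ.* (n C k)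
absorption n zero = trans (ℕ.+-identityʳ _) (trans (nC1≡n (suc n)) (sym (ℕ.*-identityʳ (suc n))))
absorption zero (suc k) = trans (cong (suc (suc k) ℕ.*_) (k>n⇒nCk≡0 {1} {suc (suc k)} (s≤s (s≤s z≤n))))
  (trans (ℕ.*-zeroʳ (suc (suc k))) (sym (trans (ℕ.*-identityˡ _) (k>n⇒nCk≡0 {0} {suc k} (s≤s z≤n)))))
absorption (suc n) (suc k) = begin
  suc (suc k) ℕ.* (suc (suc n) C suc (suc k))
    ≡⟨ cong (suc (suc k) ℕ.*_) (nCk+nC[k+1]≡[n+1]C[k+1] (suc n) (suc k)) ⟨
  suc (suc k) ℕ.* (a ℕ.+ b)
    ≡⟨ ℕ.*-distribˡ-+ (suc (suc k)) a b ⟩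
  (a ℕ.+ suc k ℕ.* a) ℕ.+ suc (suc k) ℕ.* b
    ≡⟨ cong₂ (λ s t → (a ℕ.+ s) ℕ.+ t) (absorption n k) (absorption n (suc k)) ⟩
  (a ℕ.+ suc n ℕ.* (n C k)) ℕ.+ suc n ℕ.* (n C suc k)
    ≡⟨ ℕ.+-assoc a _ _ ⟩
  a ℕ.+ (suc n ℕ.* (n C k) ℕ.+ suc n ℕ.* (n C suc k))
    ≡⟨ cong (a ℕ.+_) (ℕ.*-distribˡ-+ (suc n) (n C k) (n C suc k)) ⟨
  a ℕ.+ suc n ℕ.* (n C k ℕ.+ n C suc k)
    ≡⟨ cong (λ s → a ℕ.+ suc n ℕ.* s) (nCk+nC[k+1]≡[n+1]C[k+1] n k) ⟩
  suc (suc n) ℕ.* a ∎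
  where
  open ≡-Reasoning
  a = suc n C suc k
  b = suc n C suc (suc k)

centralBinomial : ℕ → ℤ
centralBinomial n = + ((2 ℕ.* n) C n)

-- Absorption is applied at 2n+2 and at 2n+1, with the symmetry C(2n+1,n) = C(2n+1,n+1) in between.
-- This leaves an extra factor n+1 on both sides, which is cancelled.
centralBinomial-suc : ∀ n → (+ 1 + + n) * centralBinomial (suc n) ≡
                            + 2 * (+ 2 * + n + + 1) * centralBinomial n
centralBinomial-suc n = begin
  + suc n * + (suc (n ℕ.+ suc (n ℕ.+ 0)) C suc n) ≡⟨ pos-* (suc n) _ ⟨
  + (suc n ℕ.* (suc (n ℕ.+ suc (n ℕ.+ 0)) C suc n))
    ≡⟨ cong (λ k → + (suc n ℕ.* (suc k C suc n))) (ℕ.+-suc n (n ℕ.+ 0)) ⟩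
  + (suc n ℕ.* (suc (suc N) C suc n))  ≡⟨ cong +_ (ℕ.*-cancelˡ-≡ _ _ (suc n) squared) ⟩
  + (2 ℕ.* (suc N ℕ.* (N C n)))        ≡⟨ pos-* 2 (suc N ℕ.* (N C n)) ⟩
  + 2 * + (suc N ℕ.* (N C n))          ≡⟨ cong (+ 2 *_) (pos-* (suc N) (N C n)) ⟩
  + 2 * ((+ 1 + + N) * + (N C n))      ≡⟨ cong (λ z → + 2 * ((+ 1 + z) * + (N C n))) (pos-* 2 n) ⟩
  + 2 * ((+ 1 + + 2 * + n) * + (N C n)) ≡⟨ shape (+ n) (+ (N C n)) ⟩
  + 2 * (+ 2 * + n + + 1) * + (N C n)  ∎
  where
  open ≡-Reasoning
  N = 2 ℕ.* n
  shape : ∀ n z → + 2 * ((+ 1 + + 2 * n) * z) ≡ + 2 * (+ 2 * n + + 1) * z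
  shape n z = solve (n ∷ z ∷ [])
  N-n : suc N ∸ n ≡ suc n
  N-n = trans (cong (_∸ n) (trans (cong (λ k → suc (n ℕ.+ k)) (ℕ.+-identityʳ n)) (sym (ℕ.+-suc n n)))) (ℕ.m+n∸m≡n n (suc n))
  symmetric : suc N C n ≡ suc N C suc n
  symmetric = trans (nCk≡nC[n∸k] (ℕ.m≤n⇒m≤1+n (ℕ.m≤m+n n _))) (cong (suc N C_) N-n)
  regroup : ∀ a b c → a ℕ.* (2 ℕ.* b ℕ.* c) ≡ 2 ℕ.* b ℕ.* (a ℕ.* c)
  regroup a b c = ℕ-Solver.solve (a ∷ b ∷ c ∷ [])
  regroup′ : ∀ a b c → 2 ℕ.* a ℕ.* (b ℕ.* c) ≡ a ℕ.* (2 ℕ.* (b ℕ.* c))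
  regroup′ a b c = ℕ-Solver.solve (a ∷ b ∷ c ∷ [])
  doubled : suc (suc N) ≡ 2 ℕ.* suc n
  doubled = cong suc (sym (ℕ.+-suc n (n ℕ.+ 0)))
  squared : suc n ℕ.* (suc n ℕ.* (suc (suc N) C suc n)) ≡ suc n ℕ.* (2 ℕ.* (suc N ℕ.* (N C n)))
  squared = begin
    suc n ℕ.* (suc n ℕ.* (suc (suc N) C suc n)) ≡⟨ cong (suc n ℕ.*_) (absorption (suc N) n) ⟩
    suc n ℕ.* (suc (suc N) ℕ.* (suc N C n))     ≡⟨ cong₂ (λ k z → suc n ℕ.* (k ℕ.* z)) doubled symmetric ⟩
    suc n ℕ.* (2 ℕ.* suc n ℕ.* (suc N C suc n)) ≡⟨ regroup (suc n) (suc n) (suc N C suc n) ⟩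
    2 ℕ.* suc n ℕ.* (suc n ℕ.* (suc N C suc n)) ≡⟨ cong (2 ℕ.* suc n ℕ.*_) (absorption N n) ⟩
    2 ℕ.* suc n ℕ.* (suc N ℕ.* (N C n))         ≡⟨ regroup′ (suc n) (suc N) (N C n) ⟩
    suc n ℕ.* (2 ℕ.* (suc N ℕ.* (N C n)))       ∎

-- 512^n times the partial sum up to n, which is an integer.
scaledSum : ℕ → ℤ
scaledSum zero    = + 1
scaledSum (suc n) = + 512 * scaledSum n + (- + 1) ^ suc n * (+ 6 * + suc n + + 1) *
  (centralBinomial (suc n) * centralBinomial (suc n) * centralBinomial (suc n))

-- Truncated hypergeometric sums

-- With ρ i = 1 / (4 (i + 1)), the summand w a b j is (a/4)_j (b/4)_j / j!².
module Hypergeometric (M : ℤ) (ρ : ℕ → ℤ) (N : ℕ)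
  (ρ-inverse : ∀ {i} → i ℕ.< N → ρ i * (+ 4 * (+ 1 + + i)) ≈ + 1 [ M ]) where

  coeff : ℕ → ℤ
  coeff zero    = + 1
  coeff (suc j) = coeff j * (ρ j * ρ j)

  w : ℤ → ℤ → ℕ → ℤ
  w a b j = poch (+ 4) a j * poch (+ 4) b j * coeff j

  -- As unordered pairs, {x, x+2} and {x+2, x+4} differ only in x against x+4, that is, one
  -- parameter x/4 moves by 1. The summands share the factor of x+2, and the difference of the two
  -- sums telescopes in j, leaving a multiple of the last summand.
  contiguous₁ : ∀ x j → j ℕ.≤ N →
    - x * ∑ j (w x (x + + 2)) ≈
    (- (+ 2 * x) - + 2) * ∑ j (w (x + + 2) (x + + 4)) + (+ 4 * + j + + 2 + x) * w (x + + 2) (x + + 4) j [ M ]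
  contiguous₁ x zero    _   = ≈-reflexive base
    where
    base : - x * + 1 ≡ (- (+ 2 * x) - + 2) * + 1 + (+ 4 * + 0 + + 2 + x) * + 1
    base = solve (x ∷ [])
  contiguous₁ x (suc j) j<N = step (+ j) _ _ (poch (+ 4) (x + + 2) j) (poch (+ 4) (x + + 4) j) (coeff j) (ρ j) _
    (poch-suc (+ 4) x j) (ρ-inverse j<N) (contiguous₁ x j (ℕ.<⇒≤ j<N))
    where
    step : ∀ J a b V Y c r U → U ≡ x * Y → r * (+ 4 * (+ 1 + J)) ≈ + 1 [ M ] →
      - x * a ≈ (- (+ 2 * x) - + 2) * b + (+ 4 * J + + 2 + x) * (V * Y * c) [ M ] →
      - x * (a + U * (V * (x + + 2 + J * + 4)) * (c * (r * r))) ≈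
      (- (+ 2 * x) - + 2) * (b + V * (x + + 2 + J * + 4) * (Y * (x + + 4 + J * + 4)) * (c * (r * r))) +
      (+ 4 * (+ 1 + J) + + 2 + x) * (V * (x + + 2 + J * + 4) * (Y * (x + + 4 + J * + 4)) * (c * (r * r))) [ M ]
    step J a b V Y c r _ refl inv ih =
      -- The summand involves r^2, so the inverse is used squared: with u = 4(J+1), (ru)^2 - 1 = (ru
      -- + 1)(ru - 1).
      lincomb₂ (+ 1) (- (V * Y * c * (+ 4 * J + + 2 + x) * (r * (+ 4 * (+ 1 + J)) + + 1))) ih inv
        (solve (x ∷ J ∷ a ∷ b ∷ V ∷ Y ∷ c ∷ r ∷ []))

  -- The same telescoping with the common parameter left free: `contiguous₁` is the case t = -(x+2),
  -- y = x, since `w` is symmetric in its parameters.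
  contiguous₂ : ∀ t y j → j ℕ.≤ N →
    - y * ∑ j (w (- t) y) ≈
    (t - y) * ∑ j (w (- t) (y + + 4)) + (+ 4 * + j - t) * w (- t) (y + + 4) j [ M ]
  contiguous₂ t y zero    _   = ≈-reflexive base
    where
    base : - y * + 1 ≡ (t - y) * + 1 + (+ 4 * + 0 - t) * + 1
    base = solve (t ∷ y ∷ [])
  contiguous₂ t y (suc j) j<N = step (+ j) _ _ (poch (+ 4) (- t) j) (poch (+ 4) (y + + 4) j) (coeff j) (ρ j) _
    (poch-suc (+ 4) y j) (ρ-inverse j<N) (contiguous₂ t y j (ℕ.<⇒≤ j<N))
    where
    step : ∀ J a b X Y c r U → U ≡ y * Y → r * (+ 4 * (+ 1 + J)) ≈ + 1 [ M ] →
      - y * a ≈ (t - y) * b + (+ 4 * J - t) * (X * Y * c) [ M ] →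
      - y * (a + X * (- t + J * + 4) * U * (c * (r * r))) ≈
      (t - y) * (b + X * (- t + J * + 4) * (Y * (y + + 4 + J * + 4)) * (c * (r * r))) +
      (+ 4 * (+ 1 + J) - t) * (X * (- t + J * + 4) * (Y * (y + + 4 + J * + 4)) * (c * (r * r))) [ M ]
    step J a b X Y c r _ refl inv ih =
      lincomb₂ (+ 1) (- (X * Y * c * (+ 4 * J - t) * (r * (+ 4 * (+ 1 + J)) + + 1))) ih inv
        (solve (t ∷ y ∷ J ∷ a ∷ b ∷ X ∷ Y ∷ c ∷ r ∷ []))

  x⟨_⟩ : ℕ → ℤ
  x⟨ n ⟩ = - (+ 2 * + n + + 1)

  x⟨suc⟩ : ∀ n → x⟨ suc n ⟩ + + 2 ≡ x⟨ n ⟩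
  x⟨suc⟩ n = lemma (+ n)
    where
    lemma : ∀ n → - (+ 2 * (+ 1 + n) + + 1) + + 2 ≡ - (+ 2 * n + + 1)
    lemma n = solve (n ∷ [])

  x⟨suc⟩′ : ∀ n → x⟨ suc n ⟩ + + 4 ≡ x⟨ n ⟩ + + 2
  x⟨suc⟩′ n = lemma (+ n)
    where
    lemma : ∀ n → - (+ 2 * (+ 1 + n) + + 1) + + 4 ≡ - (+ 2 * n + + 1) + + 2
    lemma n = solve (n ∷ [])

  -- The two rising factorials start at 1-2n and 3-2n with step 4, so together they run through all
  -- odd numbers from -(2n-1) to 2n-1, with product (-1)^n ((2n-1)!!)^2. Moreover 2^n (2n-1)!! / n!
  -- = C(2n,n). Passing to n+1 adds the two outer factors -(2n+1) and 2n+1.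
  endpoint : ∀ n → n ℕ.≤ N → (+ 64) ^ n * w (x⟨ n ⟩ + + 2) (x⟨ n ⟩ + + 4) n ≈
             (- + 1) ^ n * (centralBinomial n * centralBinomial n) [ M ]
  endpoint zero    _   = ≈-refl
  endpoint (suc n) n<N = subst₂ (λ a b → (+ 64) ^ suc n * w a b (suc n) ≈
      (- + 1) ^ suc n * (centralBinomial (suc n) * centralBinomial (suc n)) [ M ])
    (sym (x⟨suc⟩ n)) (sym (x⟨suc⟩′ n))
    (step (+ n) ((+ 64) ^ n) ((- + 1) ^ n) (poch (+ 4) (x⟨ n ⟩ + + 2) n) (poch (+ 4) (x⟨ n ⟩ + + 4) n) (coeff n) (ρ n)
      (centralBinomial n) (centralBinomial (suc n)) _
      (poch-suc (+ 4) x⟨ n ⟩ n) (ρ-inverse n<N) (≈-reflexive (centralBinomial-suc n)) (endpoint n (ℕ.<⇒≤ n<N)))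
    where
    step : ∀ n K s V Y c r b b′ U → let x = - (+ 2 * n + + 1) in
      U ≡ x * Y → r * (+ 4 * (+ 1 + n)) ≈ + 1 [ M ] →
      (+ 1 + n) * b′ ≈ + 2 * (+ 2 * n + + 1) * b [ M ] →
      K * (V * Y * c) ≈ s * (b * b) [ M ] →
      + 64 * K * (U * (V * (x + + 2 + n * + 4)) * (c * (r * r))) ≈ - + 1 * s * (b′ * b′) [ M ]
    step n K s V Y c r b b′ _ refl inv cb ih =
      lincomb₃ (- (+ 64 * ((+ 2 * n + + 1) * (+ 2 * n + + 1) * (r * r))))
        (- (s * (b′ * b′)) * (r * (+ 4 * (+ 1 + n)) + + 1))
        (+ 16 * s * (r * r) * (+ 2 * (+ 2 * n + + 1) * b + (+ 1 + n) * b′)) ih inv cb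
        (solve (n ∷ K ∷ s ∷ V ∷ Y ∷ c ∷ r ∷ b ∷ b′ ∷ []))

  -- Induction on n by `contiguous₁` at x = -(2n+3). Its first coefficient -2x-2 = 4(n+1) combines
  -- with the recursion for C(2n,n) to 8(2n+1), and 8 * 64 = 512. The last summand B gets the total
  -- coefficient 4(n+1) - x = 6(n+1)+1, and `endpoint` turns it into the cube: this is the origin of
  -- the factor 6n+1.
  scaledSum-w : ∀ n → n ℕ.≤ N → scaledSum n ≈
    (+ 2 * + n + + 1) * centralBinomial n * (+ 64) ^ n * ∑ n (w x⟨ n ⟩ (x⟨ n ⟩ + + 2)) [ M ]
  scaledSum-w zero    _   = ≈-refl
  scaledSum-w (suc n) n<N =
    step (+ n) ((+ 64) ^ n) ((- + 1) ^ n) (scaledSum n)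
      (centralBinomial n) (centralBinomial (suc n)) _ _ _
      (scaledSum-w n (ℕ.<⇒≤ n<N)) (≈-reflexive (centralBinomial-suc n))
      (subst₂ (λ a b → - x⟨ suc n ⟩ * φ ≈ (- (+ 2 * x⟨ suc n ⟩) - + 2) * (∑ n (w a b) + B) +
                  (+ 4 * + suc n + + 2 + x⟨ suc n ⟩) * B [ M ])
        (x⟨suc⟩ n) (x⟨suc⟩′ n) (contiguous₁ x⟨ suc n ⟩ (suc n) n<N))
      (endpoint (suc n) n<N)
    where
    φ = ∑ (suc n) (w x⟨ suc n ⟩ (x⟨ suc n ⟩ + + 2))
    B = w (x⟨ suc n ⟩ + + 2) (x⟨ suc n ⟩ + + 4) (suc n)
    step : ∀ n K s S b b′ φ φ′ B → let x = - (+ 2 * (+ 1 + n) + + 1) in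
      S ≈ (+ 2 * n + + 1) * b * K * φ [ M ] →
      (+ 1 + n) * b′ ≈ + 2 * (+ 2 * n + + 1) * b [ M ] →
      - x * φ′ ≈ (- (+ 2 * x) - + 2) * (φ + B) + (+ 4 * (+ 1 + n) + + 2 + x) * B [ M ] →
      + 64 * K * B ≈ - + 1 * s * (b′ * b′) [ M ] →
      + 512 * S + - + 1 * s * (+ 6 * (+ 1 + n) + + 1) * (b′ * b′ * b′) ≈
      (+ 2 * (+ 1 + n) + + 1) * b′ * (+ 64 * K) * φ′ [ M ]
    step n K s S b b′ φ φ′ B ih cb con end =
      lincomb₄ (+ 512) (- (+ 256 * K * φ)) (- (b′ * (+ 64 * K))) (- ((+ 6 * (+ 1 + n) + + 1) * b′))
        ih cb con end (solve (n ∷ K ∷ s ∷ S ∷ b ∷ b′ ∷ φ ∷ φ′ ∷ B ∷ []))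

-- The recursion in n with T fixed, modulo the cube of T

poch-reflect : ∀ k → poch (+ 4) (- (+ 4 * + k)) k ≡ (- + 1) ^ k * poch (+ 4) (+ 4) k
poch-reflect zero    = refl
poch-reflect (suc k) = trans (poch-suc (+ 4) _ k) (trans
  (cong (λ z → - (+ 4 * + suc k) * poch (+ 4) z k) (lower (+ k)))
  (trans (cong (- (+ 4 * + suc k) *_) (poch-reflect k)) (regroup (+ k) ((- + 1) ^ k) (poch (+ 4) (+ 4) k))))
  where
  lower : ∀ k → - (+ 4 * (+ 1 + k)) + + 4 ≡ - (+ 4 * k)
  lower k = solve (k ∷ [])
  regroup : ∀ k s F → - (+ 4 * (+ 1 + k)) * (s * F) ≡ - + 1 * s * (F * (+ 4 + k * + 4))
  regroup k s F = solve (k ∷ s ∷ F ∷ [])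

module Cubic (T : ℤ) (ρ : ℕ → ℤ) (N : ℕ)
  (ρ-inverse : ∀ {i} → i ℕ.< N → ρ i * (+ 4 * (+ 1 + + i)) ≈ + 1 [ T * T * T ]) where

  open Hypergeometric (T * T * T) ρ N ρ-inverse

  T³≈0 : T * T * T ≈ + 0 [ T * T * T ]
  T³≈0 = cong-by (+ 1) (base (T * T * T))
    where
    base : ∀ x → x - + 0 ≡ + 1 * x
    base x = solve (x ∷ [])

  T≈0 : ∀ x → x * T ≈ + 0 [ T ]
  T≈0 x = cong-by x (solve (x ∷ T ∷ []))

  φ : ℕ → ℤ
  φ n = ∑ n (w (- T) (T - + 4 * + n))

  -- With t = T/4, the product of 1 - e t/i over 1 ≤ i ≤ n; the values e = 1, 2, 4 occur.
  Q : ℤ → ℕ → ℤ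
  Q e zero    = + 1
  Q e (suc n) = Q e n * (+ 1 - e * T * ρ n)

  Q≈1 : ∀ e n → Q e n ≈ + 1 [ T ]
  Q≈1 e zero    = ≈-refl
  Q≈1 e (suc n) = step (Q e n) (ρ n) (Q≈1 e n)
    where
    step : ∀ Q r → Q ≈ + 1 [ T ] → Q * (+ 1 - e * T * r) ≈ + 1 [ T ]
    step Q r ih = lincomb₂ (+ 1) (- + 1) ih (T≈0 (Q * e * r)) (solve (T ∷ e ∷ Q ∷ r ∷ []))

  -- One sixteenth of the sum of (-1)^i / i^2, so that T^2 times it is t^2 times that sum.
  alternating : ℕ → ℤ
  alternating zero    = + 0
  alternating (suc k) = alternating k + (- + 1) ^ suc k * (ρ k * ρ k)

  coeff-inverse : ∀ k → k ℕ.≤ N → poch (+ 4) (+ 4) k * poch (+ 4) (+ 4) k * coeff k ≈ + 1 [ T * T * T ]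
  coeff-inverse zero    _   = ≈-refl
  coeff-inverse (suc k) k<N =
    step (+ k) (poch (+ 4) (+ 4) k) (coeff k) (ρ k) (ρ-inverse k<N) (coeff-inverse k (ℕ.<⇒≤ k<N))
    where
    step : ∀ k F c r → r * (+ 4 * (+ 1 + k)) ≈ + 1 [ T * T * T ] → F * F * c ≈ + 1 [ T * T * T ] →
      F * (+ 4 + k * + 4) * (F * (+ 4 + k * + 4)) * (c * (r * r)) ≈ + 1 [ T * T * T ]
    step k F c r inv ih = lincomb₂ ((r * (+ 4 * (+ 1 + k))) * (r * (+ 4 * (+ 1 + k)))) (r * (+ 4 * (+ 1 + k)) + + 1)
      ih inv (solve (k ∷ F ∷ c ∷ r ∷ []))

  -- The first factor of the first rising factorial is -T and the last factor of the second is T.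
  -- These supply T^2, so the remaining factors are needed only modulo T, where they are k! and
  -- (-1)^k k! up to powers of 4.
  boundary : ∀ k → k ℕ.< N → w (- T) (T - + 4 * + k) (suc k) ≈
    (- + 1) ^ suc k * (T * T) * (ρ k * ρ k) [ T * T * T ]
  boundary k k<N = step (+ k) ((- + 1) ^ k) (poch (+ 4) (- T + + 4) k) (poch (+ 4) (T - + 4 * + k) k) (coeff k) (ρ k) _
    (poch-suc (+ 4) (- T) k) (≈-scale (T * T) (combine (poch (+ 4) (+ 4) k) (coeff k) ((- + 1) ^ k)
      (poch-cong (+ 4) k negligible₁)
      (≈-trans (poch-cong (+ 4) k (negligible₂ (+ k)))
               (≈-reflexive (poch-reflect k)))
      (≈-weaken (T * T) (coeff-inverse k (ℕ.<⇒≤ k<N)))))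
    where
    negligible₁ : - T + + 4 ≈ + 4 [ T ]
    negligible₁ = lincomb₁ (- + 1) (T≈0 (+ 1)) (solve (T ∷ []))
    negligible₂ : ∀ k → T - + 4 * k ≈ - (+ 4 * k) [ T ]
    negligible₂ k = lincomb₁ (+ 1) (T≈0 (+ 1)) (solve (T ∷ k ∷ []))
    combine : ∀ F c s {X Y} → X ≈ F [ T ] → Y ≈ s * F [ T ] → F * F * c ≈ + 1 [ T ] → X * Y * c ≈ s [ T ]
    combine F c s x y u = ≈-trans (≈-* (≈-* x y) ≈-refl) (lincomb₁ s u (solve (F ∷ c ∷ s ∷ [])))
    step : ∀ k s X Y c r U → U ≡ - T * X → T * T * (X * Y * c) ≈ T * T * s [ T * T * T ] →
      U * (Y * (T - + 4 * k + k * + 4)) * (c * (r * r)) ≈ - + 1 * s * (T * T) * (r * r) [ T * T * T ]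
    step k s X Y c r _ refl h = lincomb₁ (- (r * r)) h (solve (T ∷ k ∷ s ∷ X ∷ Y ∷ c ∷ r ∷ []))

  -- At y = T - 4(k+1), `contiguous₂` multiplied by r = `ρ k` reads (1 - Tr) φ(k+1) = φ(k) + (2 -
  -- Tr) B. The factor 1 - Tr is the one by which `Q (+ 1)` grows, so Qφ changes only by a multiple
  -- of B.
  Qφ : ∀ n → n ℕ.≤ N → Q (+ 1) n * φ n ≈ + 1 + + 2 * (T * T) * alternating n [ T * T * T ]
  Qφ zero    _   = ≈-reflexive (base (T * T))
    where
    base : ∀ x → + 1 ≡ + 1 + + 2 * x * + 0
    base x = solve (x ∷ [])
  Qφ (suc k) k<N = step (+ k) ((- + 1) ^ k) (Q (+ 1) k) (φ k) (φ (suc k)) B (alternating k) (ρ k)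
    (ρ-inverse k<N)
    (subst (λ z → - y * φ (suc k) ≈ (T - y) * (∑ k (w (- T) z) + w (- T) z (suc k)) +
              (+ 4 * + suc k - T) * w (- T) z (suc k) [ T * T * T ])
           (raise (+ k)) (contiguous₂ T y (suc k) k<N))
    (boundary k k<N) (≈-scale (T * T) (Q≈1 (+ 1) k)) (Qφ k (ℕ.<⇒≤ k<N))
    where
    y = T - + 4 * + suc k
    B = w (- T) (T - + 4 * + k) (suc k)
    raise : ∀ k → T - + 4 * (+ 1 + k) + + 4 ≡ T - + 4 * k
    raise k = solve (T ∷ k ∷ [])
    step : ∀ k s Q φ φ′ B a r → let y = T - + 4 * (+ 1 + k) in
      r * (+ 4 * (+ 1 + k)) ≈ + 1 [ T * T * T ] →
      - y * φ′ ≈ (T - y) * (φ + B) + (+ 4 * (+ 1 + k) - T) * B [ T * T * T ] →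
      B ≈ - + 1 * s * (T * T) * (r * r) [ T * T * T ] →
      T * T * Q ≈ T * T * + 1 [ T * T * T ] →
      Q * φ ≈ + 1 + + 2 * (T * T) * a [ T * T * T ] →
      Q * (+ 1 - + 1 * T * r) * φ′ ≈ + 1 + + 2 * (T * T) * (a + - + 1 * s * (r * r)) [ T * T * T ]
    step k s Q φ φ′ B a r inv con bd sc ih =
      lincomb₄ (+ 1) (r * Q) (Q * φ + + 2 * Q * B - Q * φ′) (+ 1) ih con inv new
        (solve (T ∷ k ∷ s ∷ Q ∷ φ ∷ φ′ ∷ B ∷ a ∷ r ∷ []))
      where
      -- B carries T^2, so Q may be replaced by 1 and Tr dropped; this leaves 2B, the source of the
      -- coefficient 2.
      new : Q * (+ 2 - T * r) * B ≈ + 2 * (T * T) * (- + 1 * s * (r * r)) [ T * T * T ]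
      new = lincomb₃ (Q * (+ 2 - T * r)) (- (+ 2 * s * (r * r))) (s * (r * (r * r)) * Q) bd sc T³≈0
        (solve (T ∷ s ∷ Q ∷ B ∷ r ∷ []))

-- Products of the factors 1 - e T / (4 i)

-- Both product forms of n! C(2n,n) below are read from the top: at n = m the largest factors are 2m
-- = T-1 and 2m-1 = T-2, so the factors become T - i and T - 2i.
poch-reverse : ∀ d x n → poch d x n ≡ poch (- d) (x + + n * d - d) n
poch-reverse d x zero    = refl
poch-reverse d x (suc n) = sym (trans (poch-suc (- d) (x + + suc n * d - d) n) (trans
  (cong₂ (λ a b → a * poch (- d) b n) (first (+ n)) (rest (+ n)))
  (trans (cong ((x + + n * d) *_) (sym (poch-reverse d x n))) (*-comm (x + + n * d) _))))
  where
  first : ∀ n → x + (+ 1 + n) * d - d ≡ x + n * d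
  first n = solve (d ∷ x ∷ n ∷ [])
  rest : ∀ n → x + (+ 1 + n) * d - d + - d ≡ x + n * d - d
  rest n = solve (d ∷ x ∷ n ∷ [])

centralBinomial-poch₁ : ∀ n → poch (+ 1) (+ 1) n * centralBinomial n ≡ poch (+ 1) (+ 1 + + n) n
centralBinomial-poch₁ zero    = refl
centralBinomial-poch₁ (suc n) = *-cancelˡ-≡ (+ suc n) _ _ (trans
  (regroup (+ n) (poch (+ 1) (+ 1) n) _ _ _ (centralBinomial-suc n) (centralBinomial-poch₁ n))
  (trans (poch-suc (+ 1) (+ 1 + + n) (suc n))
         (cong (λ z → + suc n * poch (+ 1) z (suc n)) (shift (+ n)))))
  where
  shift : ∀ n → + 1 + n + + 1 ≡ + 1 + (+ 1 + n)
  shift n = solve (n ∷ [])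
  regroup : ∀ n F b b′ Y → (+ 1 + n) * b′ ≡ + 2 * (+ 2 * n + + 1) * b → F * b ≡ Y →
    (+ 1 + n) * (F * (+ 1 + n * + 1) * b′) ≡ Y * (+ 1 + n + n * + 1) * (+ 1 + n + (+ 1 + n) * + 1)
  regroup n F b b′ _ e refl = trans (left n F b′) (trans (cong ((+ 1 + n) * F *_) e) (right n F b))
    where
    left : ∀ n F b′ → (+ 1 + n) * (F * (+ 1 + n * + 1) * b′) ≡ (+ 1 + n) * F * ((+ 1 + n) * b′)
    left n F b′ = solve (n ∷ F ∷ b′ ∷ [])
    right : ∀ n F b → (+ 1 + n) * F * (+ 2 * (+ 2 * n + + 1) * b) ≡
                      F * b * (+ 1 + n + n * + 1) * (+ 1 + n + (+ 1 + n) * + 1)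
    right n F b = solve (n ∷ F ∷ b ∷ [])

centralBinomial-poch₂ : ∀ n → poch (+ 1) (+ 1) n * centralBinomial n ≡ (+ 2) ^ n * poch (+ 2) (+ 1) n
centralBinomial-poch₂ zero    = refl
centralBinomial-poch₂ (suc n) = begin
  F * (+ 1 + + n * + 1) * centralBinomial (suc n)      ≡⟨ left (+ n) F (centralBinomial (suc n)) ⟩
  F * ((+ 1 + + n) * centralBinomial (suc n))          ≡⟨ cong (F *_) (centralBinomial-suc n) ⟩
  F * (+ 2 * (+ 2 * + n + + 1) * centralBinomial n)    ≡⟨ middle (+ n) F (centralBinomial n) ⟩
  + 2 * (+ 2 * + n + + 1) * (F * centralBinomial n)    ≡⟨ cong (+ 2 * (+ 2 * + n + + 1) *_) (centralBinomial-poch₂ n) ⟩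
  + 2 * (+ 2 * + n + + 1) * ((+ 2) ^ n * poch (+ 2) (+ 1) n) ≡⟨ right (+ n) ((+ 2) ^ n) (poch (+ 2) (+ 1) n) ⟩
  + 2 * (+ 2) ^ n * (poch (+ 2) (+ 1) n * (+ 1 + + n * + 2)) ∎
  where
  open ≡-Reasoning
  F = poch (+ 1) (+ 1) n
  left : ∀ n F b → F * (+ 1 + n * + 1) * b ≡ F * ((+ 1 + n) * b)
  left n F b = solve (n ∷ F ∷ b ∷ [])
  middle : ∀ n F b → F * (+ 2 * (+ 2 * n + + 1) * b) ≡ + 2 * (+ 2 * n + + 1) * (F * b)
  middle n F b = solve (n ∷ F ∷ b ∷ [])
  right : ∀ n L p → + 2 * (+ 2 * n + + 1) * (L * p) ≡ + 2 * L * (p * (+ 1 + n * + 2))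
  right n L p = solve (n ∷ L ∷ p ∷ [])

newton : ℤ → ℤ → ℤ
newton u v = v * (+ 2 - u * v)

-- Each Newton step squares the error, so two steps pass from T through T^2 to T^4.
newton⁴-inverse : ∀ u v {T} → v * u ≈ + 1 [ T ] → newton u (newton u v) * u ≈ + 1 [ T * (T * T * T) ]
newton⁴-inverse u v {T} p = subst (λ M → newton u (newton u v) * u ≈ + 1 [ M ]) (regroup T)
  (inverse-lift u (newton u v) (inverse-lift u v p p) (inverse-lift u v p p))
  where
  regroup : ∀ T → T * T * (T * T) ≡ T * (T * T * T)
  regroup T = solve (T ∷ [])

unit-lift : ∀ u v {T} → v * u ≈ + 1 [ T ] → ∃ λ v′ → v′ * u ≈ + 1 [ T * T * T ]
unit-lift u v {T} p = newton u (newton u v) , ≈-weaken T (newton⁴-inverse u v p)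

sign-square : ∀ n → (- + 1) ^ n * (- + 1) ^ n ≡ + 1
sign-square zero    = refl
sign-square (suc n) = trans (double ((- + 1) ^ n)) (sign-square n)
  where
  double : ∀ s → - + 1 * s * (- + 1 * s) ≡ s * s
  double s = solve (s ∷ [])

module Products (T : ℤ) (ρ : ℕ → ℤ) (N : ℕ)
  (ρ-inverse : ∀ {i} → i ℕ.< N → ρ i * (+ 4 * (+ 1 + + i)) ≈ + 1 [ T * T * T ]) where

  open Cubic T ρ N ρ-inverse

  ∏ρ : ℕ → ℤ
  ∏ρ zero    = + 1
  ∏ρ (suc n) = ∏ρ n * ρ n

  ∏ρ-inverse : ∀ n → n ℕ.≤ N → (+ 4) ^ n * poch (+ 1) (+ 1) n * ∏ρ n ≈ + 1 [ T * T * T ]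
  ∏ρ-inverse zero    _   = ≈-refl
  ∏ρ-inverse (suc n) n<N =
    step (+ n) ((+ 4) ^ n) (poch (+ 1) (+ 1) n) (∏ρ n) (ρ n) (ρ-inverse n<N) (∏ρ-inverse n (ℕ.<⇒≤ n<N))
    where
    step : ∀ n K F f r → r * (+ 4 * (+ 1 + n)) ≈ + 1 [ T * T * T ] → K * F * f ≈ + 1 [ T * T * T ] →
      + 4 * K * (F * (+ 1 + n * + 1)) * (f * r) ≈ + 1 [ T * T * T ]
    step n K F f r inv ih = lincomb₂ (r * (+ 4 * (+ 1 + n))) (+ 1) ih inv (solve (n ∷ K ∷ F ∷ f ∷ r ∷ []))

  -- Since c e = 4, multiplying T - c i by e/(4i) gives -(1 - e t/i). The pairs (c, e) = (1, 4) and
  -- (2, 2) serve the two product forms of C(2m,m).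
  poch-Q : ∀ c e → c * e ≡ + 4 → ∀ n → n ℕ.≤ N →
    poch (- c) (T - c) n * (e ^ n * ∏ρ n) ≈ (- + 1) ^ n * Q e n [ T * T * T ]
  poch-Q c e ce zero    _   = ≈-refl
  poch-Q c e ce (suc n) n<N =
    step (+ n) ((- + 1) ^ n) (poch (- c) (T - c) n) (e ^ n) (∏ρ n) (ρ n) (Q e n)
      (subst (λ z → ρ n * (z * (+ 1 + + n)) ≈ + 1 [ T * T * T ]) (sym ce) (ρ-inverse n<N))
      (poch-Q c e ce n (ℕ.<⇒≤ n<N))
    where
    step : ∀ n s p E f r Q → r * (c * e * (+ 1 + n)) ≈ + 1 [ T * T * T ] → p * (E * f) ≈ s * Q [ T * T * T ] →
      p * (T - c + n * - c) * (e * E * (f * r)) ≈ - + 1 * s * (Q * (+ 1 - e * T * r)) [ T * T * T ]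
    step n s p E f r Q inv ih = lincomb₂ ((T - c + n * - c) * (e * r)) (- (s * Q)) ih inv
      (solve (T ∷ c ∷ e ∷ n ∷ s ∷ p ∷ E ∷ f ∷ r ∷ Q ∷ []))

  squares : ℕ → ℤ
  squares n = ∑< n (λ i → ρ i * ρ i)

  -- (1 - 2x)³ = (1 - x)² (1 - 4x) + 3x² - 4x³.
  Q-cubic : ∀ n → Q (+ 2) n * Q (+ 2) n * Q (+ 2) n ≈
    Q (+ 1) n * Q (+ 1) n * Q (+ 4) n + + 3 * (T * T) * squares n [ T * T * T ]
  Q-cubic zero    = ≈-reflexive (base (T * T))
    where
    base : ∀ x → + 1 ≡ + 1 + + 3 * x * + 0
    base x = solve (x ∷ [])
  Q-cubic (suc n) = step (Q (+ 2) n) (Q (+ 1) n) (Q (+ 4) n) (squares n) (ρ n) (Q-cubic n)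
    (≈-scale (T * T) (≈-* (≈-* (Q≈1 (+ 1) n) (Q≈1 (+ 1) n)) (Q≈1 (+ 4) n)))
    where
    step : ∀ A B C H r → A * A * A ≈ B * B * C + + 3 * (T * T) * H [ T * T * T ] →
      T * T * (B * B * C) ≈ T * T * + 1 [ T * T * T ] →
      A * (+ 1 - + 2 * T * r) * (A * (+ 1 - + 2 * T * r)) * (A * (+ 1 - + 2 * T * r)) ≈
      B * (+ 1 - + 1 * T * r) * (B * (+ 1 - + 1 * T * r)) * (C * (+ 1 - + 4 * T * r)) +
      + 3 * (T * T) * (H + r * r) [ T * T * T ]
    step A B C H r ih sc = lincomb₃
      ((+ 1 - + 2 * T * r) * (+ 1 - + 2 * T * r) * (+ 1 - + 2 * T * r)) (+ 3 * r * r)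
      (- (+ 4 * r * r * r * B * B * C) + + 3 * H * (- (+ 6 * r) + + 12 * r * r * T - + 8 * r * r * r * T * T))
      ih sc T³≈0 (solve (T ∷ A ∷ B ∷ C ∷ H ∷ r ∷ []))

  -- The midpoint n = m, where T = 2m + 1

  module Midpoint (m : ℕ) (T≡ : T ≡ + 2 * + m + + 1) (m≤N : m ℕ.≤ N) (squares≈0 : squares m ≈ + 0 [ T ])
    (half : ℤ) (half-inverse : half * + 2 ≈ + 1 [ T ])
    (ℓ : ℤ) (ℓ²≡1 : ℓ * ℓ ≡ + 1) (ℓ≈ : (+ 2) ^ m ≈ ℓ [ T ]) where

    private
      b = centralBinomial m
      F = poch (+ 1) (+ 1) m
      s = (- + 1) ^ m
      K = (+ 4) ^ m
      L = (+ 2) ^ m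
      f = ∏ρ m

    K≡L² : ∀ m → (+ 4) ^ m ≡ (+ 2) ^ m * (+ 2) ^ m
    K≡L² zero    = refl
    K≡L² (suc m) = trans (cong (+ 4 *_) (K≡L² m)) (regroup ((+ 2) ^ m))
      where
      regroup : ∀ L → + 4 * (L * L) ≡ + 2 * L * (+ 2 * L)
      regroup L = solve (L ∷ [])

    centralBinomial-Q₄ : b ≈ s * Q (+ 4) m [ T * T * T ]
    centralBinomial-Q₄ = combine b F K f (poch (- + 1) (T - + 1) m) (s * Q (+ 4) m)
      (poch-Q (+ 1) (+ 4) refl m m≤N) (∏ρ-inverse m m≤N)
      (≈-reflexive (trans (centralBinomial-poch₁ m) (trans (poch-reverse (+ 1) (+ 1 + + m) m)
        (cong (λ z → poch (- + 1) z m) (trans (last (+ m)) (cong (_- + 1) (sym T≡)))))))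
      where
      last : ∀ m → + 1 + m + m * + 1 - + 1 ≡ + 2 * m + + 1 - + 1
      last m = solve (m ∷ [])
      combine : ∀ b F K f p sQ → p * (K * f) ≈ sQ [ T * T * T ] → K * F * f ≈ + 1 [ T * T * T ] →
        F * b ≈ p [ T * T * T ] → b ≈ sQ [ T * T * T ]
      combine b F K f p sQ h inv e = lincomb₃ (+ 1) (- b) (K * f) h inv e (solve (b ∷ F ∷ K ∷ f ∷ p ∷ sQ ∷ []))

    centralBinomial-Q₂ : b ≈ K * (s * Q (+ 2) m) [ T * T * T ]
    centralBinomial-Q₂ = combine b F K f L (poch (- + 2) (T - + 2) m) (s * Q (+ 2) m) (poch-Q (+ 2) (+ 2) refl m m≤N) (∏ρ-inverse m m≤N)
      (≈-reflexive (trans (centralBinomial-poch₂ m) (cong (L *_) (trans (poch-reverse (+ 2) (+ 1) m)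
        (cong (λ z → poch (- + 2) z m) (trans (last (+ m)) (cong (_- + 2) (sym T≡))))))))
      where
      last : ∀ m → + 1 + m * + 2 - + 2 ≡ + 2 * m + + 1 - + 2
      last m = solve (m ∷ [])
      combine : ∀ b F K f L p sQ → p * (L * f) ≈ sQ [ T * T * T ] → K * F * f ≈ + 1 [ T * T * T ] →
        F * b ≈ L * p [ T * T * T ] → b ≈ K * sQ [ T * T * T ]
      combine b F K f L p sQ h inv e =
        lincomb₃ K (- b) (K * f) h inv e (solve (b ∷ F ∷ K ∷ f ∷ L ∷ p ∷ sQ ∷ []))

    Q₄≈KQ₂ : Q (+ 4) m ≈ K * Q (+ 2) m [ T * T * T ]
    Q₄≈KQ₂ = combine b s K (Q (+ 4) m) (Q (+ 2) m) centralBinomial-Q₄ centralBinomial-Q₂ (≈-reflexive (sign-square m))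
      where
      combine : ∀ b s K Q₄ Q₂ → b ≈ s * Q₄ [ T * T * T ] → b ≈ K * (s * Q₂) [ T * T * T ] →
        s * s ≈ + 1 [ T * T * T ] → Q₄ ≈ K * Q₂ [ T * T * T ]
      combine b s K Q₄ Q₂ h k ss = lincomb₃ (- s) s (K * Q₂ - Q₄) h k ss (solve (b ∷ s ∷ K ∷ Q₄ ∷ Q₂ ∷ []))

    -- In the cubic relation the sum of squares drops out and `Q (+ 4) m` becomes L^2 times
    -- `Q (+ 2) m`. One factor `Q (+ 2) m`, a unit because it is 1 modulo T, then cancels.
    Q₂²≈ : Q (+ 2) m * Q (+ 2) m ≈ L * Q (+ 1) m * (L * Q (+ 1) m) [ T * T * T ]
    Q₂²≈ = cancel (Q (+ 2) m) (Q (+ 1) m) (Q (+ 4) m) (squares m) L (proj₁ inverse) (proj₂ inverse)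
      (Q-cubic m) (subst (λ K → Q (+ 4) m ≈ K * Q (+ 2) m [ T * T * T ]) (K≡L² m) Q₄≈KQ₂)
      (≈-scale (T * T) squares≈0)
      where
      inverse : ∃ λ v → v * Q (+ 2) m ≈ + 1 [ T * T * T ]
      inverse = unit-lift (Q (+ 2) m) (+ 1) (≈-trans (≈-reflexive (*-identityˡ _)) (Q≈1 (+ 2) m))
      cancel : ∀ A B C H L v → v * A ≈ + 1 [ T * T * T ] →
        A * A * A ≈ B * B * C + + 3 * (T * T) * H [ T * T * T ] →
        C ≈ L * L * A [ T * T * T ] → T * T * H ≈ T * T * + 0 [ T * T * T ] →
        A * A ≈ L * B * (L * B) [ T * T * T ]
      cancel A B C H L v unit h c z = ≈-cancel {u = A} {v = v} unit
        (lincomb₃ (+ 1) (B * B) (+ 3) h c z (solve (T ∷ A ∷ B ∷ C ∷ H ∷ L ∷ [])))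

    -- The squares of both sides agree, so (A - ℓLB)(A + ℓLB) vanishes modulo T^3. Modulo T the
    -- second factor is 1 + ℓ^2 = 2, hence a unit, and the first must vanish.
    Q₂≈ : Q (+ 2) m ≈ ℓ * L * Q (+ 1) m [ T * T * T ]
    Q₂≈ = root (Q (+ 2) m) L (Q (+ 1) m) (proj₁ inverse) (proj₂ inverse) Q₂²≈ (≈-reflexive ℓ²≡1)
      where
      unit : ∀ A L B → A ≈ + 1 [ T ] → B ≈ + 1 [ T ] → L ≈ ℓ [ T ] → ℓ * ℓ ≈ + 1 [ T ] →
        half * (A + ℓ * L * B) ≈ + 1 [ T ]
      unit A L B a b l ll = ≈-trans (≈-*ˡ half two) half-inverse
        where
        two : A + ℓ * L * B ≈ + 2 [ T ]
        two = lincomb₄ (+ 1) (ℓ * L) ℓ (+ 1) a b l ll (solve (A ∷ L ∷ B ∷ ℓ ∷ []))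
      inverse : ∃ λ v → v * (Q (+ 2) m + ℓ * L * Q (+ 1) m) ≈ + 1 [ T * T * T ]
      inverse = unit-lift (Q (+ 2) m + ℓ * L * Q (+ 1) m) half
        (unit (Q (+ 2) m) L (Q (+ 1) m) (Q≈1 (+ 2) m) (Q≈1 (+ 1) m) ℓ≈ (≈-reflexive ℓ²≡1))
      root : ∀ A L B v → v * (A + ℓ * L * B) ≈ + 1 [ T * T * T ] →
        A * A ≈ L * B * (L * B) [ T * T * T ] → ℓ * ℓ ≈ + 1 [ T * T * T ] → A ≈ ℓ * L * B [ T * T * T ]
      root A L B v u h ll = ≈-cancel {u = A + ℓ * L * B} {v = v} u
        (lincomb₂ (+ 1) (- (L * B * (L * B))) h ll (solve (A ∷ L ∷ B ∷ ℓ ∷ [])))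

    centralBinomial-φ : b * φ m ≈ s * K * L * ℓ * (+ 1 + + 2 * (T * T) * alternating m) [ T * T * T ]
    centralBinomial-φ = combine b s K L (Q (+ 2) m) (Q (+ 1) m) (φ m) (+ 1 + + 2 * (T * T) * alternating m)
      centralBinomial-Q₂ Q₂≈ (Qφ m m≤N)
      where
      combine : ∀ b s K L A B φ z → b ≈ K * (s * A) [ T * T * T ] → A ≈ ℓ * L * B [ T * T * T ] →
        B * φ ≈ z [ T * T * T ] → b * φ ≈ s * K * L * ℓ * z [ T * T * T ]
      combine b s K L A B φ z h k g =
        lincomb₃ φ (K * s * φ) (s * K * L * ℓ) h k g (solve (b ∷ s ∷ K ∷ L ∷ A ∷ B ∷ φ ∷ z ∷ ℓ ∷ []))

-- Binomial sums

∑-cong : ∀ {M} n {f g} → (∀ k → k ℕ.≤ n → f k ≈ g k [ M ]) → ∑ n f ≈ ∑ n g [ M ]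
∑-cong zero    h = h 0 z≤n
∑-cong (suc n) h = ≈-+ (∑-cong n (λ k k≤n → h k (ℕ.m≤n⇒m≤1+n k≤n))) (h (suc n) ℕ.≤-refl)

∑-cong-≡ : ∀ n {f g} → (∀ k → k ℕ.≤ n → f k ≡ g k) → ∑ n f ≡ ∑ n g
∑-cong-≡ zero    h = h 0 z≤n
∑-cong-≡ (suc n) h = cong₂ _+_ (∑-cong-≡ n (λ k k≤n → h k (ℕ.m≤n⇒m≤1+n k≤n))) (h (suc n) ℕ.≤-refl)

∑-+ : ∀ n f g → ∑ n (λ k → f k + g k) ≡ ∑ n f + ∑ n g
∑-+ zero    f g = refl
∑-+ (suc n) f g = trans (cong (_+ (f (suc n) + g (suc n))) (∑-+ n f g)) (regroup (∑ n f) (∑ n g) (f (suc n)) (g (suc n)))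
  where
  regroup : ∀ a b c d → a + b + (c + d) ≡ a + c + (b + d)
  regroup a b c d = solve (a ∷ b ∷ c ∷ d ∷ [])

∑-* : ∀ n c f → ∑ n (λ k → c * f k) ≡ c * ∑ n f
∑-* zero    c f = refl
∑-* (suc n) c f = trans (cong (_+ c * f (suc n)) (∑-* n c f)) (sym (*-distribˡ-+ c _ _))

∑-shift : ∀ n f → ∑ (suc n) f ≡ f 0 + ∑ n (λ k → f (suc k))
∑-shift zero    f = refl
∑-shift (suc n) f = trans (cong (_+ f (suc (suc n))) (∑-shift n f)) (+-assoc (f 0) _ _)

∑-ends : ∀ {M} n f → (∀ k → k ℕ.< n → f (suc k) ≈ + 0 [ M ]) → ∑ (suc n) f ≈ f 0 + f (suc n) [ M ]
∑-ends zero    f h = ≈-refl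
∑-ends (suc n) f h = ≈-+ (≈-trans (∑-ends n f (λ k k<n → h k (ℕ.m≤n⇒m≤1+n k<n)))
  (≈-trans (≈-+ (≈-refl {x = f 0}) (h n ℕ.≤-refl)) (≈-reflexive (+-identityʳ (f 0))))) ≈-refl

-- Passing both k and n - k to g turns Pascal's rule into a shift of one argument or the other.
binomialSum : ℕ → (ℕ → ℕ → ℤ) → ℤ
binomialSum n g = ∑ n (λ k → + (n C k) * g k (n ∸ k))

binomialSum-suc : ∀ n g → binomialSum (suc n) g ≡
  binomialSum n (λ i j → g (suc i) j) + binomialSum n (λ i j → g i (suc j))
binomialSum-suc n g = begin
  binomialSum (suc n) g                                       ≡⟨ ∑-shift n (λ k → + (suc n C k) * g k (suc n ∸ k)) ⟩
  g₀ + ∑ n (λ k → + (suc n C suc k) * g (suc k) (n ∸ k))      ≡⟨ cong (_+_ g₀) (∑-cong-≡ n (λ k _ → pascal k)) ⟩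
  g₀ + ∑ n (λ k → A k + B k)                                  ≡⟨ cong (_+_ g₀) (∑-+ n A B) ⟩
  g₀ + (∑ n A + ∑ n B)                                        ≡⟨ swap g₀ (∑ n A) (∑ n B) ⟩
  ∑ n A + (g₀ + ∑ n B)                                        ≡⟨ cong (_+_ (∑ n A)) (∑-shift n h) ⟨
  ∑ n A + (∑ n h + h (suc n))                                 ≡⟨ cong (λ z → ∑ n A + (∑ n h + z)) h-last ⟩
  ∑ n A + (∑ n h + + 0)                                       ≡⟨ cong (_+_ (∑ n A)) (+-identityʳ (∑ n h)) ⟩
  ∑ n A + ∑ n h                                               ≡⟨ cong (_+_ (∑ n A)) (∑-cong-≡ n (λ k k≤n →
                                                                   cong (λ j → + (n C k) * g k j) (ℕ.+-∸-assoc 1 k≤n))) ⟩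
  ∑ n A + binomialSum n (λ i j → g i (suc j))                 ∎
  where
  open ≡-Reasoning
  g₀ = + 1 * g 0 (suc n)
  A = λ k → + (n C k) * g (suc k) (n ∸ k)
  B = λ k → + (n C suc k) * g (suc k) (n ∸ k)
  h = λ k → + (n C k) * g k (suc n ∸ k)
  swap : ∀ a b c → a + (b + c) ≡ b + (a + c)
  swap a b c = solve (a ∷ b ∷ c ∷ [])
  pascal : ∀ k → + (suc n C suc k) * g (suc k) (n ∸ k) ≡ A k + B k
  pascal k = trans (cong (λ c → + c * g (suc k) (n ∸ k)) (sym (nCk+nC[k+1]≡[n+1]C[k+1] n k)))
    (*-distribʳ-+ (g (suc k) (n ∸ k)) (+ (n C k)) (+ (n C suc k)))
  h-last : h (suc n) ≡ + 0
  h-last = cong (λ c → + c * g (suc n) (suc n ∸ suc n)) (k>n⇒nCk≡0 (ℕ.n<1+n n))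

binomialSum-* : ∀ n c g → binomialSum n (λ i j → c * g i j) ≡ c * binomialSum n g
binomialSum-* n c g = trans (∑-cong-≡ n (λ k _ → swap (+ (n C k)) c (g k (n ∸ k)))) (∑-* n c _)
  where
  swap : ∀ a b d → a * (b * d) ≡ b * (a * d)
  swap a b d = solve (a ∷ b ∷ d ∷ [])

binomialSum-+ : ∀ n g h → binomialSum n (λ i j → g i j + h i j) ≡ binomialSum n g + binomialSum n h
binomialSum-+ n g h = trans (∑-cong-≡ n (λ k _ → *-distribˡ-+ (+ (n C k)) (g k (n ∸ k)) (h k (n ∸ k)))) (∑-+ n _ _)

binomial : ∀ x y n → (x + y) ^ n ≡ binomialSum n (λ i j → x ^ i * y ^ j)
binomial x y zero    = refl
binomial x y (suc n) = sym (begin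
  binomialSum (suc n) (λ i j → x ^ i * y ^ j) ≡⟨ binomialSum-suc n (λ i j → x ^ i * y ^ j) ⟩
  binomialSum n (λ i j → x * x ^ i * y ^ j) + binomialSum n (λ i j → x ^ i * (y * y ^ j))
    ≡⟨ cong₂ _+_ (∑-cong-≡ n (λ k _ → cong (+ (n C k) *_) (*-assoc x (x ^ k) (y ^ (n ∸ k)))))
                 (∑-cong-≡ n (λ k _ → cong (+ (n C k) *_) (swap (x ^ k) y (y ^ (n ∸ k))))) ⟩
  binomialSum n (λ i j → x * (x ^ i * y ^ j)) + binomialSum n (λ i j → y * (x ^ i * y ^ j))
    ≡⟨ cong₂ _+_ (binomialSum-* n x (λ i j → x ^ i * y ^ j)) (binomialSum-* n y (λ i j → x ^ i * y ^ j)) ⟩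
  x * binomialSum n (λ i j → x ^ i * y ^ j) + y * binomialSum n (λ i j → x ^ i * y ^ j)
    ≡⟨ *-distribʳ-+ (binomialSum n (λ i j → x ^ i * y ^ j)) x y ⟨
  (x + y) * binomialSum n (λ i j → x ^ i * y ^ j) ≡⟨ cong ((x + y) *_) (binomial x y n) ⟨
  (x + y) * (x + y) ^ n ∎)
  where
  open ≡-Reasoning
  swap : ∀ a b d → a * (b * d) ≡ b * (a * d)
  swap a b d = solve (a ∷ b ∷ d ∷ [])

-- Euler numbers

evenPart : ℕ → ℤ → ℤ
evenPart zero          x = x
evenPart (suc zero)    x = + 0
evenPart (suc (suc n)) x = evenPart n x

-- The functions behind euler are private to Defs.  They are recovered as
-- solutions of unification problems: abstracting every argument of a private
-- function from the normal form of a goal leaves a pattern equation for a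
-- metavariable.  eulerList n i is the i-th entry of [E_n, ..., E_0], and
-- eulerSum n m l g is Σ_{k≤n, m-k even} C(m,k) g (l k).
mutual
  eulerList : ℕ → ℕ → ℤ
  eulerList = _

  euler≡eulerList : ∀ n → euler n ≡ eulerList n 0
  euler≡eulerList n with 0
  ... | i = refl

mutual
  eulerSum : ℕ → ℕ → (ℕ → ℕ) → (ℕ → ℤ) → ℤ
  eulerSum = _

  euler≡eulerSum : ∀ n → euler (suc n) ≡ - eulerSum n (suc n) (n ∸_) (eulerList n)
  euler≡eulerSum n with suc n | eulerList n | (n ∸_)
  ... | m | g | l = refl

-- At k = 0 both `m ∸ 0` and `m C 0` reduce, so this summand depends only on m and the list entry;
-- later summands also need the binomial coefficient as an argument.
mutual
  firstTerm : ℕ → ℤ → ℤ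
  firstTerm = _

  eulerSum-zero : ∀ m l g → eulerSum 0 m l g ≡ firstTerm m (g (l 0))
  eulerSum-zero m l g with g (l 0)
  ... | z = refl

mutual
  addTerm : ℤ → ℕ → ℕ → ℤ → ℤ
  addTerm = _

  eulerSum-suc : ∀ n m l g → eulerSum (suc n) m l g ≡
    addTerm (eulerSum n m l g) (m ∸ suc n) (m C suc n) (g (l (suc n)))
  eulerSum-suc n m l g with eulerSum n m l g | m ∸ suc n | m C suc n | g (l (suc n))
  ... | a | d | c | z = refl

firstTerm≡ : ∀ d z → firstTerm d z ≡ evenPart d z
firstTerm≡ zero          z = *-identityˡ z
firstTerm≡ (suc zero)    z = refl
firstTerm≡ (suc (suc d)) z = firstTerm≡ d z

addTerm≡ : ∀ a d c z → addTerm a d c z ≡ a + evenPart d (+ c * z)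
addTerm≡ a zero          c z = refl
addTerm≡ a (suc zero)    c z = refl
addTerm≡ a (suc (suc d)) c z = addTerm≡ a d c z

eulerSum≡∑ : ∀ n m l g → eulerSum n m l g ≡ ∑ n (λ k → evenPart (m ∸ k) (+ (m C k) * g (l k)))
eulerSum≡∑ zero m l g = trans (eulerSum-zero m l g)
  (trans (firstTerm≡ m (g (l 0))) (cong (evenPart m) (sym (*-identityˡ _))))
eulerSum≡∑ (suc n) m l g = trans (eulerSum-suc n m l g)
  (trans (addTerm≡ (eulerSum n m l g) (m ∸ suc n) (m C suc n) (g (l (suc n))))
    (cong (_+ evenPart (m ∸ suc n) (+ (m C suc n) * g (l (suc n)))) (eulerSum≡∑ n m l g)))

eulerList≡euler : ∀ k j → eulerList (j ℕ.+ k) j ≡ euler k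
eulerList≡euler k zero    = sym (euler≡eulerList k)
eulerList≡euler k (suc j) = eulerList≡euler k j

evenPart-* : ∀ d c x → evenPart d (c * x) ≡ c * evenPart d x
evenPart-* zero          c x = refl
evenPart-* (suc zero)    c x = sym (*-zeroʳ c)
evenPart-* (suc (suc d)) c x = evenPart-* d c x

evenPart-+ : ∀ d x y → evenPart d (x + y) ≡ evenPart d x + evenPart d y
evenPart-+ zero          x y = refl
evenPart-+ (suc zero)    x y = refl
evenPart-+ (suc (suc d)) x y = evenPart-+ d x y

evenPart-0 : ∀ d → evenPart d (+ 0) ≡ + 0
evenPart-0 zero          = refl
evenPart-0 (suc zero)    = refl
evenPart-0 (suc (suc d)) = evenPart-0 d

evenPart-cong : ∀ {M x y} d → x ≈ y [ M ] → evenPart d x ≈ evenPart d y [ M ]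
evenPart-cong zero          p = p
evenPart-cong (suc zero)    p = ≈-refl
evenPart-cong (suc (suc d)) p = evenPart-cong d p

2*evenPart : ∀ d x → + 2 * evenPart d x ≡ x * (+ 1) ^ d + x * (- + 1) ^ d
2*evenPart zero          x = base x
  where
  base : ∀ x → + 2 * x ≡ x * + 1 + x * + 1
  base x = solve (x ∷ [])
2*evenPart (suc zero)    x = base x
  where
  base : ∀ x → + 2 * + 0 ≡ x * + 1 + x * (- + 1)
  base x = solve (x ∷ [])
2*evenPart (suc (suc d)) x = trans (2*evenPart d x) (step x ((+ 1) ^ d) ((- + 1) ^ d))
  where
  step : ∀ x a b → x * a + x * b ≡ x * (+ 1 * (+ 1 * a)) + x * (- + 1 * (- + 1 * b))
  step x a b = solve (x ∷ a ∷ b ∷ [])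

evenBinomialSum : ℕ → (ℕ → ℤ) → ℤ
evenBinomialSum n e = binomialSum n (λ i j → evenPart j (e i))

euler-recurrence : ∀ n → evenBinomialSum (suc n) euler ≡ + 0
euler-recurrence n = trans (cong₂ _+_ initial final) (+-inverseʳ S)
  where
  S = eulerSum n (suc n) (n ∸_) (eulerList n)
  initial : ∑ n (λ k → + (suc n C k) * evenPart (suc n ∸ k) (euler k)) ≡ S
  initial = sym (trans (eulerSum≡∑ n (suc n) (n ∸_) (eulerList n)) (∑-cong-≡ n λ k k≤n →
    trans (evenPart-* (suc n ∸ k) (+ (suc n C k)) _)
      (cong (λ z → + (suc n C k) * evenPart (suc n ∸ k) z)
        (subst (λ j → eulerList j (n ∸ k) ≡ euler k) (ℕ.m∸n+n≡m k≤n) (eulerList≡euler k (n ∸ k))))))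
  final : + (suc n C suc n) * evenPart (n ∸ n) (euler (suc n)) ≡ - S
  final = trans (cong₂ (λ c d → + c * evenPart d (euler (suc n))) (nCn≡1 (suc n)) (ℕ.n∸n≡0 n))
    (trans (*-identityˡ _) (euler≡eulerSum n))

-- The recurrence is triangular with diagonal coefficient C(n+1,n+1) = 1, so it fixes e (n+1) by the
-- earlier values. The bound k ≤ n carries the strong induction.
evenBinomialSum-unique : ∀ {M} e → e 0 ≈ + 0 [ M ] →
  (∀ n → evenBinomialSum (suc n) e ≈ + 0 [ M ]) → ∀ n k → k ℕ.≤ n → e k ≈ + 0 [ M ]
evenBinomialSum-unique e e₀ rec zero    zero z≤n = e₀
evenBinomialSum-unique {M} e e₀ rec (suc n) k k≤1+n with ℕ.m≤n⇒m<n∨m≡n k≤1+n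
... | inj₁ (s≤s k≤n) = evenBinomialSum-unique e e₀ rec n k k≤n
... | inj₂ refl      = ≈-trans (≈-sym (≈-trans (≈-+ initial ≈-refl) (≈-reflexive final))) (rec n)
  where
  zeros : ∀ n → ∑ n (λ _ → + 0) ≡ + 0
  zeros zero    = refl
  zeros (suc n) = trans (+-identityʳ _) (zeros n)
  initial : ∑ n (λ k → + (suc n C k) * evenPart (suc n ∸ k) (e k)) ≈ + 0 [ M ]
  initial = ≈-trans (∑-cong n λ k k≤n → ≈-trans
      (≈-*ˡ (+ (suc n C k)) (≈-trans (evenPart-cong (suc n ∸ k) (evenBinomialSum-unique e e₀ rec n k k≤n))
                                     (≈-reflexive (evenPart-0 (suc n ∸ k)))))
      (≈-reflexive (*-zeroʳ (+ (suc n C k)))))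
    (≈-reflexive (zeros n))
  final : + 0 + + (suc n C suc n) * evenPart (n ∸ n) (e (suc n)) ≡ e (suc n)
  final = trans (+-identityˡ _) (trans
    (cong₂ (λ c d → + c * evenPart d (e (suc n))) (nCn≡1 (suc n)) (ℕ.n∸n≡0 n)) (*-identityˡ _))

evenBinomialSum-^ : ∀ n x → + 2 * evenBinomialSum n (x ^_) ≡ (x + + 1) ^ n + (x - + 1) ^ n
evenBinomialSum-^ n x = begin
  + 2 * evenBinomialSum n (x ^_)                            ≡⟨ binomialSum-* n (+ 2) (λ i j → evenPart j (x ^ i)) ⟨
  binomialSum n (λ i j → + 2 * evenPart j (x ^ i))          ≡⟨ ∑-cong-≡ n (λ k _ → cong (+ (n C k) *_) (2*evenPart (n ∸ k) (x ^ k))) ⟩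
  binomialSum n (λ i j → x ^ i * (+ 1) ^ j + x ^ i * (- + 1) ^ j)
    ≡⟨ binomialSum-+ n (λ i j → x ^ i * (+ 1) ^ j) (λ i j → x ^ i * (- + 1) ^ j) ⟩
  binomialSum n (λ i j → x ^ i * (+ 1) ^ j) + binomialSum n (λ i j → x ^ i * (- + 1) ^ j)
    ≡⟨ cong₂ _+_ (binomial x (+ 1) n) (binomial x (- + 1) n) ⟨
  (x + + 1) ^ n + (x - + 1) ^ n                             ∎
  where open ≡-Reasoning

-- Σ_{|s|≤m} (-1)^s (2s)^k.
alternatingPower : ℕ → ℕ → ℤ
alternatingPower zero    k = (+ 0) ^ k
alternatingPower (suc m) k = alternatingPower m k +
  (- + 1) ^ suc m * ((+ 2 * + suc m) ^ k + (- (+ 2 * + suc m)) ^ k)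

-- By `evenBinomialSum-^` each base 2s contributes the n-th powers of 2s+1 and 2s-1. Neighbouring
-- even bases share an odd number and carry opposite signs, so only the outermost numbers 2m+1 and
-- -(2m+1) survive.
evenBinomialSum-alternatingPower : ∀ m n → + 2 * evenBinomialSum n (alternatingPower m) ≡
  (- + 1) ^ m * ((+ 2 * + m + + 1) ^ n + (- (+ 2 * + m + + 1)) ^ n)
evenBinomialSum-alternatingPower zero    n = trans (evenBinomialSum-^ n (+ 0)) (sym (*-identityˡ _))
evenBinomialSum-alternatingPower (suc m) n = begin
  + 2 * evenBinomialSum n (alternatingPower (suc m))
    ≡⟨ cong (+ 2 *_) (trans (∑-cong-≡ n (λ k _ → cong (+ (n C k) *_) (linear (n ∸ k) (alternatingPower m k) (u ^ k) ((- u) ^ k))))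
        (trans (binomialSum-+ n (λ i j → evenPart j (alternatingPower m i)) (λ i j → s * (evenPart j (u ^ i) + evenPart j ((- u) ^ i))))
          (cong (_+_ (evenBinomialSum n (alternatingPower m))) (trans (binomialSum-* n s (λ i j → evenPart j (u ^ i) + evenPart j ((- u) ^ i)))
            (cong (s *_) (binomialSum-+ n (λ i j → evenPart j (u ^ i)) (λ i j → evenPart j ((- u) ^ i)))))))) ⟩
  + 2 * (evenBinomialSum n (alternatingPower m) + s * (evenBinomialSum n (u ^_) + evenBinomialSum n ((- u) ^_)))
    ≡⟨ distribute (evenBinomialSum n (alternatingPower m)) s (evenBinomialSum n (u ^_)) (evenBinomialSum n ((- u) ^_)) ⟩
  + 2 * evenBinomialSum n (alternatingPower m) + s * (+ 2 * evenBinomialSum n (u ^_) + + 2 * evenBinomialSum n ((- u) ^_))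
    ≡⟨ cong₂ (λ a b → a + s * b) (evenBinomialSum-alternatingPower m n)
        (cong₂ _+_ (evenBinomialSum-^ n u) (evenBinomialSum-^ n (- u))) ⟩
  (- + 1) ^ m * (v ^ n + (- v) ^ n) + s * ((u + + 1) ^ n + (u - + 1) ^ n + ((- u + + 1) ^ n + (- u - + 1) ^ n))
    ≡⟨ cong (λ z → (- + 1) ^ m * (v ^ n + (- v) ^ n) + s * z) (cong₂ (λ a b → (u + + 1) ^ n + a + b)
        (cong (_^ n) (down (+ m))) (cong₂ (λ a b → a ^ n + b ^ n) (down⁻ (+ m)) (up⁻ (+ m)))) ⟩
  (- + 1) ^ m * (v ^ n + (- v) ^ n) + s * ((u + + 1) ^ n + v ^ n + ((- v) ^ n + (- (u + + 1)) ^ n))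
    ≡⟨ telescope ((- + 1) ^ m) (v ^ n) ((- v) ^ n) ((u + + 1) ^ n) ((- (u + + 1)) ^ n) ⟩
  s * ((u + + 1) ^ n + (- (u + + 1)) ^ n) ∎
  where
  open ≡-Reasoning
  s = (- + 1) ^ suc m
  u = + 2 * + suc m
  v = + 2 * + m + + 1
  linear : ∀ d a b c → evenPart d (a + s * (b + c)) ≡ evenPart d a + s * (evenPart d b + evenPart d c)
  linear d a b c = trans (evenPart-+ d a (s * (b + c))) (cong (_+_ (evenPart d a))
    (trans (evenPart-* d s (b + c)) (cong (s *_) (evenPart-+ d b c))))
  distribute : ∀ a s b c → + 2 * (a + s * (b + c)) ≡ + 2 * a + s * (+ 2 * b + + 2 * c)
  distribute a s b c = solve (a ∷ s ∷ b ∷ c ∷ [])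
  down : ∀ m → + 2 * (+ 1 + m) - + 1 ≡ + 2 * m + + 1
  down m = solve (m ∷ [])
  down⁻ : ∀ m → - (+ 2 * (+ 1 + m)) + + 1 ≡ - (+ 2 * m + + 1)
  down⁻ m = solve (m ∷ [])
  up⁻ : ∀ m → - (+ 2 * (+ 1 + m)) - + 1 ≡ - (+ 2 * (+ 1 + m) + + 1)
  up⁻ m = solve (m ∷ [])
  telescope : ∀ s a b c d → s * (a + b) + - + 1 * s * (c + a + (b + d)) ≡ - + 1 * s * (c + d)
  telescope s a b c d = solve (s ∷ a ∷ b ∷ c ∷ d ∷ [])

-- For n > 0 the surviving powers are divisible by T = 2m+1, which gives Euler's recurrence. For n =
-- 0 they give e 0 = (-1)^m, the source of the sign. The difference D thus has a zero initial value
-- and satisfies the homogeneous recurrence.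
euler-alternatingPower : ∀ m {half} → half * + 2 ≈ + 1 [ + 2 * + m + + 1 ] → ∀ k →
  (- + 1) ^ m * euler k ≈ alternatingPower m k [ + 2 * + m + + 1 ]
euler-alternatingPower m {half} unit k = difference (unique k)
  where
  T = + 2 * + m + + 1
  s = (- + 1) ^ m
  e = alternatingPower m
  D : ℕ → ℤ
  D i = s * euler i + - + 1 * e i
  difference : ∀ {x y} → x + - + 1 * y ≈ + 0 [ T ] → x ≈ y [ T ]
  difference {x} {y} p = lincomb₁ (+ 1) p (solve (x ∷ y ∷ []))
  linear : ∀ d a b → evenPart d (s * a + - + 1 * b) ≡ s * evenPart d a + - + 1 * evenPart d b
  linear d a b = trans (evenPart-+ d (s * a) (- + 1 * b)) (cong₂ _+_ (evenPart-* d s a) (evenPart-* d (- + 1) b))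
  linearSum : ∀ n → evenBinomialSum n D ≡ s * evenBinomialSum n euler + - + 1 * evenBinomialSum n e
  linearSum n = trans (∑-cong-≡ n (λ k _ → cong (+ (n C k) *_) (linear (n ∸ k) (euler k) (e k))))
    (trans (binomialSum-+ n (λ i j → s * evenPart j (euler i)) (λ i j → - + 1 * evenPart j (e i)))
      (cong₂ _+_ (binomialSum-* n s (λ i j → evenPart j (euler i))) (binomialSum-* n (- + 1) (λ i j → evenPart j (e i)))))
  halve : ∀ x → + 2 * x ≈ + 0 [ T ] → x ≈ + 0 [ T ]
  halve x p = ≈-cancel {u = + 2} {v = half} unit p
  e-recurrence : ∀ n → evenBinomialSum (suc n) e ≈ + 0 [ T ]
  e-recurrence n = halve _ (≈-trans (≈-reflexive (evenBinomialSum-alternatingPower m (suc n)))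
    (multiple T s (T ^ n) ((- T) ^ n)))
    where
    multiple : ∀ T s a b → s * (T * a + - T * b) ≈ + 0 [ T ]
    multiple T s a b = cong-by (s * (a - b)) (solve (T ∷ s ∷ a ∷ b ∷ []))
  D₀ : D 0 ≈ + 0 [ T ]
  D₀ = halve _ (collect s (e 0) (≈-reflexive (evenBinomialSum-alternatingPower m 0)))
    where
    collect : ∀ s e → + 2 * (+ 1 * e) ≈ s * (+ 1 + + 1) [ T ] → + 2 * (s * + 1 + - + 1 * e) ≈ + 0 [ T ]
    collect s e p = lincomb₁ (- + 1) p (solve (s ∷ e ∷ []))
  unique : ∀ k → D k ≈ + 0 [ T ]
  unique k = evenBinomialSum-unique D D₀ (λ n → ≈-trans (≈-reflexive (trans (linearSum (suc n))
    (cong (λ z → s * z + - + 1 * evenBinomialSum (suc n) e) (euler-recurrence n))))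
    (collect s _ (e-recurrence n))) k k ℕ.≤-refl
    where
    collect : ∀ s x → x ≈ + 0 [ T ] → s * + 0 + - + 1 * x ≈ + 0 [ T ]
    collect s x p = lincomb₁ (- + 1) p (solve (s ∷ x ∷ []))

-- Arithmetic modulo a prime

-- Monic polynomial functions of degree d, described through division by x - r.
Monic : ℕ → (ℤ → ℤ) → Set
Monic zero    f = ∀ x → f x ≡ + 1
Monic (suc d) f = ∀ r → ∃ λ g → Monic d g × (∀ x → f x - f r ≡ (x - r) * g x)

Monic-+ : ∀ d {f g} c → Monic (suc d) f → Monic d g → Monic (suc d) (λ x → f x + c * g x)
Monic-+ zero {f} {g} c F G r with F r
... | h , H , e = h , H , λ x → trans
  (cong₂ (λ a b → f x + c * a - (f r + c * b)) (G x) (G r)) (trans (cancel (f x) (f r) c) (e x))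
  where
  cancel : ∀ a b c → a + c * + 1 - (b + c * + 1) ≡ a - b
  cancel a b c = solve (a ∷ b ∷ c ∷ [])
Monic-+ (suc d) {f} {g} c F G r with F r | G r
... | h , H , e | k , K , e′ = (λ x → h x + c * k x) , Monic-+ d {h} {k} c H K , λ x →
  trans (split (f x) (f r) (g x) (g r) c) (trans (cong₂ (λ a b → a + c * b) (e x) (e′ x)) (merge x (h x) (k x)))
  where
  split : ∀ a b u v c → a + c * u - (b + c * v) ≡ a - b + c * (u - v)
  split a b u v c = solve (a ∷ b ∷ u ∷ v ∷ c ∷ [])
  merge : ∀ x a b → (x - r) * a + c * ((x - r) * b) ≡ (x - r) * (a + c * b)
  merge x a b = solve (x ∷ r ∷ c ∷ a ∷ b ∷ [])

-- A Horner step: x f(x) - r f(r) = (x - r) f(x) + r (f(x) - f(r)), so if g is the quotient for f,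
-- the new one is f + r g.
Monic-x* : ∀ d {f} c → Monic d f → Monic (suc d) (λ x → x * f x + c)
Monic-x* zero {f} c F r = f , F , λ x → trans
  (cong₂ (λ a b → x * a + c - (r * b + c)) (F x) (F r)) (trans (base x) (cong ((x - r) *_) (sym (F x))))
  where
  base : ∀ x → x * + 1 + c - (r * + 1 + c) ≡ (x - r) * + 1
  base x = solve (x ∷ r ∷ c ∷ [])
Monic-x* (suc d) {f} c F r with F r
... | g , G , e = (λ x → f x + r * g x) , Monic-+ d {f} {g} r F G , λ x →
  trans (split x (f x) (f r)) (trans (cong (λ a → (x - r) * f x + r * a) (e x)) (merge x (f x) (g x)))
  where
  split : ∀ x a b → x * a + c - (r * b + c) ≡ (x - r) * a + r * (a - b)
  split x a b = solve (x ∷ r ∷ c ∷ a ∷ b ∷ [])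
  merge : ∀ x a b → (x - r) * a + r * ((x - r) * b) ≡ (x - r) * (a + r * b)
  merge x a b = solve (x ∷ r ∷ a ∷ b ∷ [])

Monic-cong : ∀ d {f g} → (∀ x → f x ≡ g x) → Monic d f → Monic d g
Monic-cong zero    e F x = trans (sym (e x)) (F x)
Monic-cong (suc d) e F r with F r
... | h , H , e′ = h , H , λ x → trans (cong₂ _-_ (sym (e x)) (sym (e r))) (e′ x)

Monic-^ : ∀ d → Monic d (_^ d)
Monic-^ zero    x = refl
Monic-^ (suc d) = Monic-cong (suc d) (λ x → +-identityʳ (x * x ^ d)) (Monic-x* d (+ 0) (Monic-^ d))

^-distribˡ-* : ∀ x y n → (x * y) ^ n ≡ x ^ n * y ^ n
^-distribˡ-* x y zero    = refl
^-distribˡ-* x y (suc n) = trans (cong (x * y *_) (^-distribˡ-* x y n)) (regroup (x ^ n) (y ^ n))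
  where
  regroup : ∀ a b → x * y * (a * b) ≡ x * a * (y * b)
  regroup a b = solve (x ∷ y ∷ a ∷ b ∷ [])

-- Writing p = 3 + k makes k the Euler index p - 3, `suc k` the exponent p - 2 of an inverse, and
-- `2 ℕ.+ k` the exponent in Fermat's theorem.
module PrimeField (k : ℕ) (p-prime : Prime (3 ℕ.+ k)) where

  p = 3 ℕ.+ k

  ∣⇒≈0 : ∀ {x} → p ∣ ∣ x ∣ → x ≈ + 0 [ + p ]
  ∣⇒≈0 {x} d with Signed.∣ᵤ⇒∣ {+ p} {x} d
  ... | Signed.divides q e = cong-by q (trans (+-identityʳ x) e)

  ≈0⇒∣ : ∀ {x} → x ≈ + 0 [ + p ] → p ∣ ∣ x ∣
  ≈0⇒∣ {x} (cong-by q e) = Signed.∣⇒∣ᵤ (Signed.divides q (trans (sym (+-identityʳ x)) e))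

  ≈⇒-≈0 : ∀ {x y} → x ≈ y [ + p ] → x - y ≈ + 0 [ + p ]
  ≈⇒-≈0 {x} {y} h = lincomb₁ (+ 1) h (solve (x ∷ y ∷ []))

  -≈0⇒≈ : ∀ x y → x - y ≈ + 0 [ + p ] → x ≈ y [ + p ]
  -≈0⇒≈ x y h = lincomb₁ (+ 1) h (solve (x ∷ y ∷ []))

  euclid : ∀ x y → x * y ≈ + 0 [ + p ] → x ≈ + 0 [ + p ] ⊎ y ≈ + 0 [ + p ]
  euclid x y h with euclidsLemma ∣ x ∣ ∣ y ∣ p-prime (subst (p ∣_) (abs-* x y) (≈0⇒∣ h))
  ... | inj₁ d = inj₁ (∣⇒≈0 d)
  ... | inj₂ d = inj₂ (∣⇒≈0 d)

  cancel : ∀ c x y → ¬ c ≈ + 0 [ + p ] → c * x ≈ c * y [ + p ] → x ≈ y [ + p ]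
  cancel c x y c≉0 h = [ (λ c≈0 → ⊥-elim (c≉0 c≈0)) , -≈0⇒≈ x y ]′
    (euclid c (x - y) (lincomb₁ (+ 1) h (solve (c ∷ x ∷ y ∷ []))))

  small≉0 : ∀ {n} → suc n ℕ.< p → ¬ + suc n ≈ + 0 [ + p ]
  small≉0 n<p h = ℕ.<⇒≱ n<p (∣⇒≤ (≈0⇒∣ h))

  small≉ : ∀ {i j} → i ℕ.< j → j ℕ.< p → ¬ + i ≈ + j [ + p ]
  small≉ {i} {j} i<j j<p h with ℕ.m≤n⇒∃[o]m+o≡n i<j
  ... | d , refl = small≉0 (ℕ.≤-<-trans (s≤s (ℕ.m≤n+m d i)) j<p)
    (≈-trans (≈-reflexive (difference (+ i) (+ d))) (≈⇒-≈0 (≈-sym h)))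
    where
    difference : ∀ i d → + 1 + d ≡ + 1 + (i + d) - i
    difference i d = solve (i ∷ d ∷ [])

  residue-unique : ∀ {i j} → i ℕ.< p → j ℕ.< p → + i ≈ + j [ + p ] → i ≡ j
  residue-unique {i} {j} i<p j<p h with ℕ.<-cmp i j
  ... | tri< i<j _ _ = ⊥-elim (small≉ i<j j<p h)
  ... | tri≈ _ e _   = e
  ... | tri> _ _ j<i = ⊥-elim (small≉ j<i i<p (≈-sym h))

  residue : ∀ x → x ≈ + (x %ℕ p) [ + p ]
  residue x = cong-by (x /ℕ p) (trans (cong (_- + (x %ℕ p)) (a≡a%ℕn+[a/ℕn]*n x p))
                                      (drop (+ (x %ℕ p)) (x /ℕ p * + p)))
    where
    drop : ∀ r q → r + q - r ≡ q
    drop r q = solve (r ∷ q ∷ [])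

  -- By absorption p divides (i+1) C(p,i+1), and 0 < i+1 < p.
  binomial≈0 : ∀ i → i ℕ.< 2 ℕ.+ k → + (p C suc i) ≈ + 0 [ + p ]
  binomial≈0 i i<p with euclidsLemma (suc i) (p C suc i) p-prime
    (subst (p ∣_) (sym (absorption (2 ℕ.+ k) i)) (m∣m*n ((2 ℕ.+ k) C i)))
  ... | inj₁ d = ⊥-elim (ℕ.<⇒≱ (s≤s i<p) (∣⇒≤ d))
  ... | inj₂ d = ∣⇒≈0 d

  frobenius : ∀ n → (+ n) ^ p ≈ + n [ + p ]
  frobenius zero    = ≈-refl
  frobenius (suc n) = begin
    (+ suc n) ^ p                       ≡⟨ cong (_^ p) (+-comm (+ 1) (+ n)) ⟩
    (+ n + + 1) ^ p                     ≡⟨ binomial (+ n) (+ 1) p ⟩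
    ∑ p f                               ≈⟨ ∑-ends (2 ℕ.+ k) f (λ i i<p →
                                             ≈-* {v = (+ n) ^ suc i * (+ 1) ^ (p ∸ suc i)} (binomial≈0 i i<p) ≈-refl) ⟩
    f 0 + f p                           ≡⟨ cong₂ _+_ first last ⟩
    + 1 + (+ n) ^ p                     ≈⟨ ≈-+ (≈-refl {x = + 1}) (frobenius n) ⟩
    + 1 + + n                           ∎
    where
    open ≈-Reasoning (+ p)
    f = λ i → + (p C i) * ((+ n) ^ i * (+ 1) ^ (p ∸ i))
    first : f 0 ≡ + 1
    first = trans (*-identityˡ _) (trans (*-identityˡ _) (^-zeroˡ p))
    last : f p ≡ (+ n) ^ p
    last = trans (cong₂ (λ c j → + c * ((+ n) ^ p * (+ 1) ^ j)) (nCn≡1 p) (ℕ.n∸n≡0 p))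
                 (trans (*-identityˡ _) (*-identityʳ _))

  fermat : ∀ x → ¬ x ≈ + 0 [ + p ] → x ^ (2 ℕ.+ k) ≈ + 1 [ + p ]
  fermat x x≉0 = cancel x _ _ x≉0 (begin
    x ^ p               ≈⟨ ≈-^ p (residue x) ⟩
    (+ (x %ℕ p)) ^ p    ≈⟨ frobenius (x %ℕ p) ⟩
    + (x %ℕ p)          ≈⟨ ≈-sym (residue x) ⟩
    x                   ≡⟨ sym (*-identityʳ x) ⟩
    x * + 1             ∎)
    where open ≈-Reasoning (+ p)

  -- Indices 0, ..., d give d+1 roots, one more than the degree. Dividing by x minus the last root
  -- lowers the degree; by Euclid's lemma the other roots are roots of the quotient.
  lagrange : ∀ d f → Monic d f → (root : ℕ → ℤ) → (∀ i → i ℕ.≤ d → f (root i) ≈ + 0 [ + p ]) →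
    (∀ i j → i ℕ.< j → j ℕ.≤ d → ¬ root i ≈ root j [ + p ]) → ⊥
  lagrange zero    f F root f≈0 _ =
    small≉0 {0} (s≤s (s≤s z≤n)) (≈-trans (≈-reflexive (sym (F (root 0)))) (f≈0 0 z≤n))
  lagrange (suc d) f F root f≈0 distinct with F (root (suc d))
  ... | g , G , e = lagrange d g G root g≈0 (λ i j i<j j≤d → distinct i j i<j (ℕ.m≤n⇒m≤1+n j≤d))
    where
    g≈0 : ∀ i → i ℕ.≤ d → g (root i) ≈ + 0 [ + p ]
    g≈0 i i≤d = [ (λ h → ⊥-elim (distinct i (suc d) (s≤s i≤d) ℕ.≤-refl (-≈0⇒≈ (root i) (root (suc d)) h))) , id ]′
      (euclid (root i - root (suc d)) (g (root i)) (≈-trans (≈-reflexive (sym (e (root i))))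
        (≈⇒-≈0 {f (root i)} {f (root (suc d))} (≈-trans (f≈0 i (ℕ.m≤n⇒m≤1+n i≤d)) (≈-sym (f≈0 (suc d) ℕ.≤-refl))))))

  -- The Legendre symbol and Euler's criterion

  legendre-view : ∀ a → ¬ a ≈ + 0 [ + p ] →
    (legendre a p ≡ + 1 × ∃ λ x → + x * + x ≈ a [ + p ]) ⊎
    (legendre a p ≡ - + 1 × (∀ x → x ℕ.< p → ¬ + x * + x ≈ a [ + p ]))
  legendre-view a a≉0 with a %ℕ p in eq
  ... | zero  = ⊥-elim (a≉0 (≈-trans (residue a) (≈-reflexive (cong +_ eq))))
  ... | suc r with any (λ x → ((x ℕ.* x) ℕ.% p) ℕ.≡ᵇ suc r) (upTo p) in eq′
  ... | true  = inj₁ (refl , x , square)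
    where
    root = find (any⁻ (λ x → ((x ℕ.* x) ℕ.% p) ℕ.≡ᵇ suc r) (upTo p) (subst Bool.T (sym eq′) _))
    x = proj₁ root
    square : + x * + x ≈ a [ + p ]
    square = ≈-trans (≈-reflexive (sym (pos-* x x))) (≈-trans (residue (+ (x ℕ.* x)))
      (≈-trans (≈-reflexive (cong +_ (trans (ℕ.≡ᵇ⇒≡ _ _ (proj₂ (proj₂ root))) (sym eq)))) (≈-sym (residue a))))
  ... | false = inj₂ (refl , nonresidue)
    where
    nonresidue : ∀ x → x ℕ.< p → ¬ + x * + x ≈ a [ + p ]
    nonresidue x x<p h = subst Bool.T eq′ (any⁺ (λ x → ((x ℕ.* x) ℕ.% p) ℕ.≡ᵇ suc r) (lose (∈-upTo⁺ x<p) (ℕ.≡⇒≡ᵇ _ _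
      (residue-unique (n%ℕd<d (+ (x ℕ.* x)) p) (subst (ℕ._< p) eq (n%ℕd<d a p))
        (≈-trans (≈-sym (residue (+ (x ℕ.* x)))) (≈-trans (≈-reflexive (pos-* x x))
          (≈-trans h (≈-trans (residue a) (≈-reflexive (cong +_ eq))))))))))

  module EulerCriterion (m′ : ℕ) (p≡ : p ≡ suc (suc m′ ℕ.+ suc m′)) where

    m = suc m′

    fermat-m : ∀ x → ¬ x ≈ + 0 [ + p ] → x ^ m * x ^ m ≈ + 1 [ + p ]
    fermat-m x x≉0 = ≈-trans (≈-reflexive (trans (sym (^-distribˡ-+-* x m m))
      (cong (x ^_) (sym (ℕ.suc-injective p≡))))) (fermat x x≉0)

    root : ℕ → ℤ
    root i = + suc i * + suc i

    bound : ∀ {i} → i ℕ.≤ m′ → suc i ℕ.< p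
    bound {i} i≤m′ = subst (suc i ℕ.<_) (sym p≡) (s≤s (ℕ.≤-trans (s≤s i≤m′) (ℕ.m≤m+n m m)))

    root≈1 : ∀ i → i ℕ.≤ m′ → root i ^ m ≈ + 1 [ + p ]
    root≈1 i i≤m′ = ≈-trans (≈-reflexive (^-distribˡ-* (+ suc i) (+ suc i) m))
      (fermat-m (+ suc i) (small≉0 (bound i≤m′)))

    -- Equal squares would force p to divide the difference or the sum of two distinct numbers
    -- between 1 and m, and both are nonzero and below p = 2m+1 in absolute value.
    roots-distinct : ∀ i j → i ℕ.< j → j ℕ.≤ m′ → ¬ root i ≈ root j [ + p ]
    roots-distinct i j i<j j≤m′ h =
      [ (λ e → small≉ (s≤s i<j) (bound j≤m′) (-≈0⇒≈ (+ suc i) (+ suc j) e))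
      , small≉0 (subst (suc i ℕ.+ suc j ℕ.<_) (sym p≡)
          (s≤s (ℕ.+-mono-≤ (s≤s (ℕ.≤-trans (ℕ.<⇒≤ i<j) j≤m′)) (s≤s j≤m′))))
      ]′ (euclid (+ suc i - + suc j) (+ suc i + + suc j)
           (≈-trans (≈-reflexive (factor (+ suc i) (+ suc j))) (≈⇒-≈0 {root i} {root j} h)))
      where
      factor : ∀ x y → (x - y) * (x + y) ≡ x * x - y * y
      factor x y = solve (x ∷ y ∷ [])

    -- If a is a square, Fermat gives 1. Otherwise a^m is 1 or -1; were it 1, the squares of 1, ...,
    -- m, none congruent to a, would be m roots of (x^m - a^m)/(x - a), which has degree m-1.
    euler-criterion : ∀ a → ¬ a ≈ + 0 [ + p ] → a ^ m ≈ legendre a p [ + p ]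
    euler-criterion a a≉0 with legendre-view a a≉0
    ... | inj₁ (e , x , h) = ≈-trans (≈-trans (≈-^ m (≈-sym h)) (≈-trans (≈-reflexive (^-distribˡ-* (+ x) (+ x) m))
        (fermat-m (+ x) (λ x≈0 → a≉0 (≈-trans (≈-sym h) (≈-* {u = + x} x≈0 ≈-refl)))))) (≈-reflexive (sym e))
    ... | inj₂ (e , h) = [ (λ z → ⊥-elim (contradiction (-≈0⇒≈ (a ^ m) (+ 1) z) (Monic-^ m a)))
                         , (λ z → ≈-trans (lincomb₁ (+ 1) z (shift (a ^ m))) (≈-reflexive (sym e)))
                         ]′ (euclid (a ^ m - + 1) (a ^ m + + 1)
                              (≈-trans (≈-reflexive (factor (a ^ m))) (≈⇒-≈0 {a ^ m * a ^ m} {+ 1} (fermat-m a a≉0))))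
      where
      factor : ∀ x → (x - + 1) * (x + + 1) ≡ x * x - + 1
      factor x = solve (x ∷ [])
      shift : ∀ x → x - - + 1 ≡ + 1 * (x + + 1 - + 0)
      shift x = solve (x ∷ [])
      contradiction : a ^ m ≈ + 1 [ + p ] → (∃ λ g → Monic m′ g × (∀ x → x ^ m - a ^ m ≡ (x - a) * g x)) → ⊥
      contradiction z (g , G , q) = lagrange m′ g G root g≈0 roots-distinct
        where
        g≈0 : ∀ i → i ℕ.≤ m′ → g (root i) ≈ + 0 [ + p ]
        g≈0 i i≤m′ = [ (λ r → ⊥-elim (h (suc i) (bound i≤m′) (-≈0⇒≈ (root i) a r))) , id ]′
          (euclid (root i - a) (g (root i)) (≈-trans (≈-reflexive (sym (q (root i))))
            (≈⇒-≈0 {root i ^ m} {a ^ m} (≈-trans (root≈1 i i≤m′) (≈-sym z)))))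

    legendre-sign : ∀ a → ¬ a ≈ + 0 [ + p ] → legendre a p ≡ + 1 ⊎ legendre a p ≡ - + 1
    legendre-sign a a≉0 with legendre-view a a≉0
    ... | inj₁ (e , _) = inj₁ e
    ... | inj₂ (e , _) = inj₂ e

-- The congruence over the integers

∑<-cong : ∀ {M} n {f g} → (∀ i → i ℕ.< n → f i ≈ g i [ M ]) → ∑< n f ≈ ∑< n g [ M ]
∑<-cong zero    h = ≈-refl
∑<-cong (suc n) h = ≈-+ (∑<-cong n (λ i i<n → h i (ℕ.m≤n⇒m≤1+n i<n))) (h n ℕ.≤-refl)

∑<-* : ∀ n c f → ∑< n (λ i → c * f i) ≡ c * ∑< n f
∑<-* zero    c f = sym (*-zeroʳ c)
∑<-* (suc n) c f = trans (cong (_+ c * f n) (∑<-* n c f)) (sym (*-distribˡ-+ c (∑< n f) (f n)))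

∑<-append : ∀ a b f → ∑< (a ℕ.+ b) f ≡ ∑< a f + ∑< b (λ i → f (a ℕ.+ i))
∑<-append a zero    f = trans (cong (λ n → ∑< n f) (ℕ.+-identityʳ a)) (sym (+-identityʳ _))
∑<-append a (suc b) f = trans (cong (λ n → ∑< n f) (ℕ.+-suc a b))
  (trans (cong (_+ f (a ℕ.+ b)) (∑<-append a b f)) (+-assoc (∑< a f) _ _))

∑<-shift : ∀ n f → ∑< (suc n) f ≡ f 0 + ∑< n (λ i → f (suc i))
∑<-shift n f = trans (∑<-append 1 n f) (cong (_+ ∑< n (λ i → f (suc i))) (+-identityˡ (f 0)))

∑<-reverse : ∀ n f → ∑< n (λ i → f (n ∸ suc i)) ≡ ∑< n f
∑<-reverse zero    f = refl
∑<-reverse (suc n) f = trans (∑<-shift n (λ i → f (n ∸ i)))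
  (trans (cong (_+_ (f n)) (∑<-reverse n f)) (+-comm (f n) _))

∑<-parity : ∀ n f → ∑< (n ℕ.+ n) f ≡ ∑< n (λ i → f (i ℕ.+ i)) + ∑< n (λ i → f (suc (i ℕ.+ i)))
∑<-parity zero    f = refl
∑<-parity (suc n) f = trans (cong (λ k → ∑< (suc k) f) (ℕ.+-suc n n))
  (trans (cong (λ z → z + f (n ℕ.+ n) + f (suc (n ℕ.+ n))) (∑<-parity n f))
    (regroup (∑< n (λ i → f (i ℕ.+ i))) (∑< n (λ i → f (suc (i ℕ.+ i)))) (f (n ℕ.+ n)) (f (suc (n ℕ.+ n)))))
  where
  regroup : ∀ a b c d → a + b + c + d ≡ a + c + (b + d)
  regroup a b c d = solve (a ∷ b ∷ c ∷ d ∷ [])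

^-sign : ∀ n → (- + 1) ^ n ≡ + 1 ⊎ (- + 1) ^ n ≡ - + 1
^-sign zero    = inj₁ refl
^-sign (suc n) = [ (λ e → inj₂ (cong (- + 1 *_) e)) , (λ e → inj₁ (cong (- + 1 *_) e)) ]′ (^-sign n)

module Assembly (k : ℕ) (p-prime : Prime (3 ℕ.+ k)) (0<k : 0 ℕ.< k)
  (m′ : ℕ) (p≡ : 3 ℕ.+ k ≡ suc (suc m′ ℕ.+ suc m′)) where

  open PrimeField k p-prime
  open EulerCriterion m′ p≡

  T = + p
  N = 2 ℕ.+ k

  N≡ : N ≡ m ℕ.+ m
  N≡ = ℕ.suc-injective p≡

  m≤N : m ℕ.≤ N
  m≤N = subst (m ℕ.≤_) (sym N≡) (ℕ.m≤m+n m m)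

  T≡ : T ≡ + 2 * + m + + 1
  T≡ = trans (cong +_ p≡) (double (+ m))
    where
    double : ∀ m → + 1 + (m + m) ≡ + 2 * m + + 1
    double m = solve (m ∷ [])

  2≉0 : ¬ + 2 ≈ + 0 [ T ]
  2≉0 = small≉0 (s≤s (s≤s (s≤s z≤n)))

  u : ℕ → ℤ
  u i = + 4 * (+ 1 + + i)

  u≉0 : ∀ {i} → i ℕ.< N → ¬ u i ≈ + 0 [ T ]
  u≉0 {i} i<N h = [ (λ e → [ 2≉0 , 2≉0 ]′ (euclid (+ 2) (+ 2) e)) , small≉0 (s≤s i<N) ]′
    (euclid (+ 4) (+ suc i) h)

  abstract
    -- Fermat makes u^(p-2) an inverse of u modulo p, and two Newton steps lift it to modulo p^4.
    ρ : ℕ → ℤ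
    ρ i = newton (u i) (newton (u i) (u i ^ suc k))

    ρ-inverse⁴ : ∀ {i} → i ℕ.< N → ρ i * (+ 4 * (+ 1 + + i)) ≈ + 1 [ T * (T * T * T) ]
    ρ-inverse⁴ {i} i<N = newton⁴-inverse (u i) (u i ^ suc k)
      (≈-trans (≈-reflexive (*-comm (u i ^ suc k) (u i))) (fermat (u i) (u≉0 i<N)))

  ρ-inverse³ : ∀ {i} → i ℕ.< N → ρ i * (+ 4 * (+ 1 + + i)) ≈ + 1 [ T * T * T ]
  ρ-inverse³ i<N = ≈-weaken T (ρ-inverse⁴ i<N)

  ρ-inverse¹ : ∀ {i} → i ℕ.< N → ρ i * (+ 4 * (+ 1 + + i)) ≈ + 1 [ T ]
  ρ-inverse¹ i<N = ≈-weaken (T * T) (ρ-inverse³ i<N)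

  half-inverse : + 2 * ρ 0 * + 2 ≈ + 1 [ T ]
  half-inverse = step (ρ 0) (ρ-inverse¹ (s≤s z≤n))
    where
    step : ∀ r → r * + 4 ≈ + 1 [ T ] → + 2 * r * + 2 ≈ + 1 [ T ]
    step r h = lincomb₁ (+ 1) h (solve (r ∷ []))

  open Cubic T ρ N ρ-inverse³ using (T≈0; φ; alternating)
  open Products T ρ N ρ-inverse³ using (squares; module Midpoint)
  open Hypergeometric (T * (T * T * T)) ρ N ρ-inverse⁴ using (w; x⟨_⟩; scaledSum-w)

  f : ℕ → ℤ
  f i = ρ i * ρ i

  f-reflect : ∀ i j → i ℕ.< N → j ℕ.< N → suc i ℕ.+ suc j ≡ p → f i ≈ f j [ T ]
  f-reflect i j i<N j<N e = step (+ suc i) (+ suc j) (ρ i) (ρ j) (ρ-inverse¹ i<N) (ρ-inverse¹ j<N)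
    (≈-trans (≈-reflexive (trans (cong +_ e) (sym (*-identityˡ T)))) (T≈0 (+ 1)))
    where
    step : ∀ a b r r′ → r * (+ 4 * a) ≈ + 1 [ T ] → r′ * (+ 4 * b) ≈ + 1 [ T ] → a + b ≈ + 0 [ T ] →
      r * r ≈ r′ * r′ [ T ]
    step a b r r′ h h′ z = lincomb₃ (- ((r - r′) * r′)) (- ((r - r′) * r)) ((r - r′) * (+ 4 * r * r′)) h h′ z
      (solve (a ∷ b ∷ r ∷ r′ ∷ []))

  -- Index i stands for the integer i+1, so index 2i+1 stands for 2(i+1).
  f-double : ∀ i → suc (i ℕ.+ i) ℕ.< N → + 4 * f (suc (i ℕ.+ i)) ≈ f i [ T ]
  f-double i i<N = step (+ i) (ρ i) (ρ (suc (i ℕ.+ i))) (ρ-inverse¹ (ℕ.≤-<-trans (ℕ.m≤n⇒m≤1+n (ℕ.m≤m+n i i)) i<N))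
    (ρ-inverse¹ i<N)
    where
    step : ∀ i r r′ → r * (+ 4 * (+ 1 + i)) ≈ + 1 [ T ] → r′ * (+ 4 * (+ 1 + (+ 1 + (i + i)))) ≈ + 1 [ T ] →
      + 4 * (r′ * r′) ≈ r * r [ T ]
    step i r r′ h h′ = lincomb₂ (- ((+ 2 * r′ + r) * (+ 2 * r′))) ((+ 2 * r′ + r) * r) h h′
      (solve (i ∷ r ∷ r′ ∷ []))

  -- With H = Σ_{i≤m} 1/i², reflection gives Σ_{i<p} 1/i² = 2H, while sorting
  -- by parity gives Σ_{i<p} 1/i² = H/4 + H/4.
  squares≈0 : squares m ≈ + 0 [ T ]
  squares≈0 = [ (λ e → ⊥-elim (2≉0 e)) , (λ e → [ (λ e′ → ⊥-elim (3≉0 e′)) , id ]′ (euclid (+ 3) (squares m) e)) ]′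
    (euclid (+ 2) (+ 3 * squares m) (combine (squares m) (∑< m even) (∑< m odd) (∑< m high)
      (≈-reflexive (trans (sym (∑<-append m m f)) (∑<-parity m f)))
      high≈ even≈ odd≈))
    where
    -- The relations below combine to 6H = 0; p > 3 allows the factor 3 to be removed.
    3≉0 : ¬ + 3 ≈ + 0 [ T ]
    3≉0 = small≉0 (s≤s (s≤s (s≤s 0<k)))
    -- The parity is that of the index, so `odd` runs over the reciprocals of even integers.
    even odd high : ℕ → ℤ
    even i = f (i ℕ.+ i)
    odd i  = f (suc (i ℕ.+ i))
    high i = f (m ℕ.+ i)
    complement : ∀ {i} → i ℕ.< m → suc i ℕ.+ (m ∸ suc i) ≡ m
    complement = ℕ.m+[n∸m]≡n
    below : ∀ {i j} → suc i ℕ.+ suc j ≡ p → j ℕ.< N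
    below {i} {j} e = subst (suc j ℕ.≤_) (ℕ.suc-injective e) (ℕ.m≤n+m (suc j) i)
    reflect : ∀ i j → suc i ℕ.+ suc j ≡ p → f i ≈ f j [ T ]
    reflect i j e = f-reflect i j (below {j} {i} (trans (ℕ.+-comm (suc j) (suc i)) e)) (below {i} {j} e) e
    sum₁ : ∀ d i → suc i ℕ.+ d ≡ m → suc (m ℕ.+ d) ℕ.+ suc i ≡ p
    sum₁ d i e = trans (regroup m d i) (trans (cong (λ z → suc (m ℕ.+ z)) e) (sym p≡))
      where
      regroup : ∀ m d i → suc (m ℕ.+ d) ℕ.+ suc i ≡ suc (m ℕ.+ (suc i ℕ.+ d))
      regroup m d i = ℕ-Solver.solve (m ∷ d ∷ i ∷ [])
    sum₂ : ∀ d i → suc i ℕ.+ d ≡ m → suc (d ℕ.+ d) ℕ.+ suc (suc (i ℕ.+ i)) ≡ p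
    sum₂ d i e = trans (regroup d i) (trans (cong (λ z → suc (z ℕ.+ z)) e) (sym p≡))
      where
      regroup : ∀ d i → suc (d ℕ.+ d) ℕ.+ suc (suc (i ℕ.+ i)) ≡ suc ((suc i ℕ.+ d) ℕ.+ (suc i ℕ.+ d))
      regroup d i = ℕ-Solver.solve (d ∷ i ∷ [])
    high≈ : ∑< m high ≈ squares m [ T ]
    high≈ = ≈-trans (≈-reflexive (sym (∑<-reverse m high)))
      (∑<-cong m (λ i i<m → reflect (m ℕ.+ (m ∸ suc i)) i (sum₁ (m ∸ suc i) i (complement i<m))))
    even≈ : ∑< m even ≈ ∑< m odd [ T ]
    even≈ = ≈-trans (≈-reflexive (sym (∑<-reverse m even)))
      (∑<-cong m (λ i i<m → reflect ((m ∸ suc i) ℕ.+ (m ∸ suc i)) (suc (i ℕ.+ i)) (sum₂ (m ∸ suc i) i (complement i<m))))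
    odd≈ : + 4 * ∑< m odd ≈ squares m [ T ]
    odd≈ = ≈-trans (≈-reflexive (sym (∑<-* m (+ 4) odd))) (∑<-cong m (λ i i<m →
      f-double i (subst (suc (i ℕ.+ i) ℕ.<_) (sym N≡) (subst (ℕ._≤ m ℕ.+ m) (cong suc (ℕ.+-suc i i)) (ℕ.+-mono-≤ i<m i<m)))))
    combine : ∀ H E O R → H + R ≈ E + O [ T ] → R ≈ H [ T ] → E ≈ O [ T ] → + 4 * O ≈ H [ T ] →
      + 2 * (+ 3 * H) ≈ + 0 [ T ]
    combine H E O R a b c d = lincomb₄ (+ 4) (- + 4) (+ 4) (+ 2) a b c d (solve (H ∷ E ∷ O ∷ R ∷ []))

  ^k-inverse : ∀ x v → ¬ x ≈ + 0 [ T ] → v * x ≈ + 1 [ T ] → x ^ k ≈ v * v [ T ]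
  ^k-inverse x v x≉0 h = step (x ^ k) (fermat x x≉0)
    where
    step : ∀ y → x * (x * y) ≈ + 1 [ T ] → y ≈ v * v [ T ]
    step y g = lincomb₂ (- (y * (v * x + + 1))) (v * v) h g (solve (x ∷ v ∷ y ∷ []))

  -- By Fermat (2i)^(p-3) is 1/(2i)^2, which is 4 times the square of 1/(4i); the bases 2i and -2i
  -- together give the factor 8.
  alternatingPower≈ : ∀ n → n ℕ.≤ N → alternatingPower n k ≈ + 8 * alternating n [ T ]
  -- The central term 0^(p-3) vanishes because p > 3; for exponent 0 it would be 1.
  alternatingPower≈ zero    _   = ≈-reflexive (zero-^ k 0<k)
    where
    zero-^ : ∀ k → 0 ℕ.< k → (+ 0) ^ k ≡ + 0
    zero-^ (suc k) _ = refl
  alternatingPower≈ (suc n) n<N = step (+ n) (ρ n) ((- + 1) ^ n) (alternatingPower n k) (alternating n)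
    (alternatingPower≈ n (ℕ.<⇒≤ n<N))
    (^k-inverse x (+ 2 * ρ n) x≉0 (inverse (+ n) (ρ n) (ρ-inverse¹ n<N)))
    (^k-inverse (- x) (- (+ 2 * ρ n)) (λ h → x≉0 (negate x h)) (inverse⁻ (+ n) (ρ n) (ρ-inverse¹ n<N)))
    where
    x = + 2 * + suc n
    x≉0 : ¬ x ≈ + 0 [ T ]
    x≉0 h = [ 2≉0 , small≉0 (s≤s n<N) ]′ (euclid (+ 2) (+ suc n) h)
    negate : ∀ x → - x ≈ + 0 [ T ] → x ≈ + 0 [ T ]
    negate x h = lincomb₁ (- + 1) h (solve (x ∷ []))
    inverse : ∀ n r → r * (+ 4 * (+ 1 + n)) ≈ + 1 [ T ] → + 2 * r * (+ 2 * (+ 1 + n)) ≈ + 1 [ T ]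
    inverse n r h = lincomb₁ (+ 1) h (solve (n ∷ r ∷ []))
    inverse⁻ : ∀ n r → r * (+ 4 * (+ 1 + n)) ≈ + 1 [ T ] → - (+ 2 * r) * - (+ 2 * (+ 1 + n)) ≈ + 1 [ T ]
    inverse⁻ n r h = lincomb₁ (+ 1) h (solve (n ∷ r ∷ []))
    step : ∀ n r s e a {y z} → e ≈ + 8 * a [ T ] → y ≈ + 2 * r * (+ 2 * r) [ T ] →
      z ≈ - (+ 2 * r) * - (+ 2 * r) [ T ] → e + - + 1 * s * (y + z) ≈ + 8 * (a + - + 1 * s * (r * r)) [ T ]
    step n r s e a {y} {z} h g g′ = lincomb₃ (+ 1) (- s) (- s) h g g′ (solve (r ∷ s ∷ e ∷ a ∷ y ∷ z ∷ []))

  s : ℤ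
  s = (- + 1) ^ m

  euler≈ : euler k ≈ + 8 * s * alternating m [ T ]
  euler≈ = step s (euler k) (alternatingPower m k) (alternating m) (≈-reflexive (sign-square m))
    (subst (λ M → s * euler k ≈ alternatingPower m k [ M ]) (sym T≡)
      (euler-alternatingPower m {+ 2 * ρ 0} (subst (λ M → + 2 * ρ 0 * + 2 ≈ + 1 [ M ]) T≡ half-inverse) k))
    (alternatingPower≈ m m≤N)
    where
    step : ∀ s E e a → s * s ≈ + 1 [ T ] → s * E ≈ e [ T ] → e ≈ + 8 * a [ T ] → E ≈ + 8 * s * a [ T ]
    step s E e a h g g′ = lincomb₃ (- E) s s h g g′ (solve (s ∷ E ∷ e ∷ a ∷ []))

  ℓ : ℤ
  ℓ = legendre (+ 2) p

  ℓ²≡1 : ℓ * ℓ ≡ + 1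
  ℓ²≡1 = [ (λ e → cong₂ _*_ e e) , (λ e → cong₂ _*_ e e) ]′ (legendre-sign (+ 2) 2≉0)

  signs-equal : ∀ {x y} → x ≡ + 1 ⊎ x ≡ - + 1 → y ≡ + 1 ⊎ y ≡ - + 1 → x ≈ y [ T ] → x ≡ y
  signs-equal (inj₁ refl) (inj₁ refl) _ = refl
  signs-equal (inj₁ refl) (inj₂ refl) h = ⊥-elim (2≉0 (≈⇒-≈0 {+ 1} { - + 1} h))
  signs-equal (inj₂ refl) (inj₁ refl) h = ⊥-elim (2≉0 (≈⇒-≈0 {+ 1} { - + 1} (≈-sym h)))
  signs-equal (inj₂ refl) (inj₂ refl) _ = refl

  -- Identifies the sign left by the product evaluation. Euler's criterion gives the congruence, and
  -- two signs congruent modulo an odd prime are equal.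
  legendre[-2] : legendre (- + 2) p ≡ s * ℓ
  legendre[-2] = signs-equal (legendre-sign (- + 2) -2≉0) (product (^-sign m) (legendre-sign (+ 2) 2≉0))
    (≈-trans (≈-sym (euler-criterion (- + 2) -2≉0)) (≈-trans (≈-reflexive (^-distribˡ-* (- + 1) (+ 2) m))
      (≈-*ˡ s (euler-criterion (+ 2) 2≉0))))
    where
    -2≉0 : ¬ - + 2 ≈ + 0 [ T ]
    -2≉0 h = 2≉0 (lincomb₁ (- + 1) h refl)
    product : ∀ {x y} → x ≡ + 1 ⊎ x ≡ - + 1 → y ≡ + 1 ⊎ y ≡ - + 1 → x * y ≡ + 1 ⊎ x * y ≡ - + 1
    product (inj₁ refl) (inj₁ refl) = inj₁ refl
    product (inj₁ refl) (inj₂ refl) = inj₂ refl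
    product (inj₂ refl) (inj₁ refl) = inj₂ refl
    product (inj₂ refl) (inj₂ refl) = inj₁ refl

  -- The meeting point of the two families: at n = m the prefactor 2n+1 is T, and the parameters
  -- -(2m+1) and 1-2m are -T and T - 4m.
  scaledSum-φ : scaledSum m ≈ T * centralBinomial m * (+ 64) ^ m * φ m [ T * (T * T * T) ]
  scaledSum-φ = ≈-trans (scaledSum-w m m≤N) (≈-reflexive (cong₂ (λ t Φ → t * centralBinomial m * (+ 64) ^ m * Φ)
    (sym T≡) (cong₂ (λ a b → ∑ m (w a b)) (cong -_ (sym T≡))
      (trans (second (+ m)) (cong (_- + 4 * + m) (sym T≡))))))
    where
    second : ∀ m → - (+ 2 * m + + 1) + + 2 ≡ + 2 * m + + 1 - + 4 * m
    second m = solve (m ∷ [])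

  powers : ∀ m → (+ 64) ^ m * ((+ 4) ^ m * (+ 2) ^ m) ≡ (+ 512) ^ m
  powers m = trans (cong ((+ 64) ^ m *_) (sym (^-distribˡ-* (+ 4) (+ 2) m))) (sym (^-distribˡ-* (+ 64) (+ 8) m))

  -- The factor T lifts the product evaluation from modulus T^3 to T^4, and T^3 lifts the congruence
  -- for the Euler number from T to T^4. The factors 4 and 512^m clear the denominators of both
  -- sides.
  integerCongruence : + 4 * scaledSum m ≈
    (+ 512) ^ m * (+ 4 * (T * legendre (- + 2) p) + T * T * T * ℓ * euler k) [ T * (T * T * T) ]
  integerCongruence = subst₂ (λ X λ₂ → + 4 * scaledSum m ≈ X * (+ 4 * (T * λ₂) + T * T * T * ℓ * euler k) [ T * (T * T * T) ])
    (powers m) (sym legendre[-2])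
    (combine (scaledSum m) (centralBinomial m) ((+ 64) ^ m) ((+ 4) ^ m) ((+ 2) ^ m) s ℓ (euler k) (alternating m) (φ m)
      scaledSum-φ
      (≈-scale T centralBinomial-φ)
      (subst (λ M → T * T * T * euler k ≈ T * T * T * (+ 8 * s * alternating m) [ M ]) (*-comm (T * T * T) T)
        (≈-scale (T * T * T) euler≈)))
    where
    open Midpoint m T≡ m≤N squares≈0 (+ 2 * ρ 0) half-inverse ℓ ℓ²≡1 (euler-criterion (+ 2) 2≉0) using (centralBinomial-φ)
    combine : ∀ S b X K L s ℓ E a φ → S ≈ T * b * X * φ [ T * (T * T * T) ] →
      T * (b * φ) ≈ T * (s * K * L * ℓ * (+ 1 + + 2 * (T * T) * a)) [ T * (T * T * T) ] →
      T * T * T * E ≈ T * T * T * (+ 8 * s * a) [ T * (T * T * T) ] →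
      + 4 * S ≈ X * (K * L) * (+ 4 * (T * (s * ℓ)) + T * T * T * ℓ * E) [ T * (T * T * T) ]
    combine S b X K L s ℓ E a φ h g e = lincomb₃ (+ 4) (+ 4 * X) (- (X * (K * L) * ℓ)) h g e (identity T)
      where
      identity : ∀ T → + 4 * S - X * (K * L) * (+ 4 * (T * (s * ℓ)) + T * T * T * ℓ * E) ≡
        + 4 * (S - T * b * X * φ) + + 4 * X * (T * (b * φ) - T * (s * K * L * ℓ * (+ 1 + + 2 * (T * T) * a))) +
        - (X * (K * L) * ℓ) * (T * T * T * E - T * T * T * (+ 8 * s * a))
      identity T = solve (S ∷ b ∷ X ∷ K ∷ L ∷ s ∷ ℓ ∷ E ∷ a ∷ φ ∷ T ∷ [])

-- Passage to the rationals

fromℚᵘ-homo-+ : ∀ x y → fromℚᵘ (x ℚᵘ.+ y) ≡ fromℚᵘ x ℚ.+ fromℚᵘ y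
fromℚᵘ-homo-+ x y = ℚ.toℚᵘ-injective (ℚᵘ.≃-trans (ℚ.toℚᵘ-fromℚᵘ (x ℚᵘ.+ y)) (ℚᵘ.≃-sym
  (ℚᵘ.≃-trans (ℚ.toℚᵘ-homo-+ (fromℚᵘ x) (fromℚᵘ y)) (ℚᵘ.+-cong (ℚ.toℚᵘ-fromℚᵘ x) (ℚ.toℚᵘ-fromℚᵘ y)))))

fromℚᵘ-homo-* : ∀ x y → fromℚᵘ (x ℚᵘ.* y) ≡ fromℚᵘ x ℚ.* fromℚᵘ y
fromℚᵘ-homo-* x y = ℚ.toℚᵘ-injective (ℚᵘ.≃-trans (ℚ.toℚᵘ-fromℚᵘ (x ℚᵘ.* y)) (ℚᵘ.≃-sym
  (ℚᵘ.≃-trans (ℚ.toℚᵘ-homo-* (fromℚᵘ x) (fromℚᵘ y)) (ℚᵘ.*-cong (ℚ.toℚᵘ-fromℚᵘ x) (ℚ.toℚᵘ-fromℚᵘ y)))))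

ι-+ : ∀ a b → ι (a + b) ≡ ι a ℚ.+ ι b
ι-+ a b = trans (ℚ.fromℚᵘ-cong {mkℚᵘ (a + b) 0} {mkℚᵘ a 0 ℚᵘ.+ mkℚᵘ b 0} (*≡* identity))
                (fromℚᵘ-homo-+ (mkℚᵘ a 0) (mkℚᵘ b 0))
  where
  identity : (a + b) * + 1 ≡ (a * + 1 + b * + 1) * + 1
  identity = solve (a ∷ b ∷ [])

ι-* : ∀ a b → ι (a * b) ≡ ι a ℚ.* ι b
ι-* a b = trans (ℚ.fromℚᵘ-cong {mkℚᵘ (a * b) 0} {mkℚᵘ a 0 ℚᵘ.* mkℚᵘ b 0} (*≡* refl))
                (fromℚᵘ-homo-* (mkℚᵘ a 0) (mkℚᵘ b 0))

/-ι : ∀ a n .{{_ : ℕ.NonZero n}} → (a ℚ./ n) ℚ.* ι (+ n) ≡ ι a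
/-ι a n@(suc d) = trans (sym (fromℚᵘ-homo-* (mkℚᵘ a d) (mkℚᵘ (+ n) 0)))
  (ℚ.fromℚᵘ-cong {mkℚᵘ a d ℚᵘ.* mkℚᵘ (+ n) 0} {mkℚᵘ a 0} (*≡* (trans (identity a (+ n))
    (cong (λ k → a * + k) (sym (ℕ.*-identityʳ n))))))
  where
  identity : ∀ a n → a * n * + 1 ≡ a * n
  identity a n = solve (a ∷ n ∷ [])

pos-^ : ∀ a n → + (a ℕ.^ n) ≡ (+ a) ^ n
pos-^ a zero    = refl
pos-^ a (suc n) = trans (pos-* a (a ℕ.^ n)) (cong (+ a *_) (pos-^ a n))

numerator : ∀ n → (- + 1) ^ n * + ((6 ℕ.* n ℕ.+ 1) ℕ.* ((2 ℕ.* n) C n) ℕ.^ 3) ≡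
  (- + 1) ^ n * (+ 6 * + n + + 1) * (centralBinomial n * centralBinomial n * centralBinomial n)
numerator n = trans (cong ((- + 1) ^ n *_) (trans (pos-* (6 ℕ.* n ℕ.+ 1) (((2 ℕ.* n) C n) ℕ.^ 3))
    (cong₂ _*_ (trans (pos-+ (6 ℕ.* n) 1) (cong (_+ + 1) (pos-* 6 n))) (pos-^ ((2 ℕ.* n) C n) 3))))
  (regroup ((- + 1) ^ n) (+ 6 * + n + + 1) (centralBinomial n))
  where
  regroup : ∀ s a b → s * (a * (b * (b * (b * + 1)))) ≡ s * a * (b * b * b)
  regroup s a b = solve (s ∷ a ∷ b ∷ [])

term-ι : ∀ n → term n ℚ.* ι ((+ 512) ^ n) ≡
  ι ((- + 1) ^ n * (+ 6 * + n + + 1) * (centralBinomial n * centralBinomial n * centralBinomial n))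
term-ι n = trans (cong (λ z → term n ℚ.* ι z) (sym (pos-^ 512 n)))
  (trans (/-ι ((- + 1) ^ n * + ((6 ℕ.* n ℕ.+ 1) ℕ.* ((2 ℕ.* n) C n) ℕ.^ 3)) (512 ℕ.^ n) {{ℕ.m^n≢0 512 n}}) (cong ι (numerator n)))

sum-ι : ∀ n → sumTo n term ℚ.* ι ((+ 512) ^ n) ≡ ι (scaledSum n)
sum-ι zero    = refl
sum-ι (suc n) = begin
  (sumTo n term ℚ.+ term (suc n)) ℚ.* ι ((+ 512) ^ suc n)
    ≡⟨ ℚ.*-distribʳ-+ (ι ((+ 512) ^ suc n)) (sumTo n term) (term (suc n)) ⟩
  sumTo n term ℚ.* ι (+ 512 * (+ 512) ^ n) ℚ.+ term (suc n) ℚ.* ι ((+ 512) ^ suc n)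
    ≡⟨ cong₂ ℚ._+_ earlier (term-ι (suc n)) ⟩
  ι (+ 512 * scaledSum n) ℚ.+ ι last
    ≡⟨ ι-+ (+ 512 * scaledSum n) last ⟨
  ι (scaledSum (suc n)) ∎
  where
  open ≡-Reasoning
  last = (- + 1) ^ suc n * (+ 6 * + suc n + + 1) *
         (centralBinomial (suc n) * centralBinomial (suc n) * centralBinomial (suc n))
  earlier : sumTo n term ℚ.* ι (+ 512 * (+ 512) ^ n) ≡ ι (+ 512 * scaledSum n)
  earlier = begin
    sumTo n term ℚ.* ι (+ 512 * (+ 512) ^ n)               ≡⟨ cong (λ z → sumTo n term ℚ.* ι z) (*-comm (+ 512) ((+ 512) ^ n)) ⟩
    sumTo n term ℚ.* ι ((+ 512) ^ n * + 512)               ≡⟨ cong (sumTo n term ℚ.*_) (ι-* ((+ 512) ^ n) (+ 512)) ⟩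
    sumTo n term ℚ.* (ι ((+ 512) ^ n) ℚ.* ι (+ 512))       ≡⟨ ℚ.*-assoc (sumTo n term) (ι ((+ 512) ^ n)) (ι (+ 512)) ⟨
    sumTo n term ℚ.* ι ((+ 512) ^ n) ℚ.* ι (+ 512)         ≡⟨ cong (ℚ._* ι (+ 512)) (sum-ι n) ⟩
    ι (scaledSum n) ℚ.* ι (+ 512)                          ≡⟨ ι-* (scaledSum n) (+ 512) ⟨
    ι (scaledSum n * + 512)                                ≡⟨ cong ι (*-comm (scaledSum n) (+ 512)) ⟩
    ι (+ 512 * scaledSum n)                                ∎

-- A common denominator v prime to p reduces the rational congruence to one between the integers v x
-- and v y.
≈⇒Congℚ : ∀ {p M A B} x y v → ¬ (p ∣ v) → x ℚ.* ι (+ v) ≡ ι A → y ℚ.* ι (+ v) ≡ ι B →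
  A ≈ B [ M ] → Congℚ p M x y
≈⇒Congℚ {p} {M} {A} {B} x y v p∤v xv yv (cong-by q e) = q , v , p∤v , (begin
  (x ℚ.- y) ℚ.* ι (+ v)                     ≡⟨ ℚ.*-distribʳ-+ (ι (+ v)) x (ℚ.- y) ⟩
  x ℚ.* ι (+ v) ℚ.+ (ℚ.- y) ℚ.* ι (+ v)     ≡⟨ cong₂ ℚ._+_ xv (sym (ℚ.neg-distribˡ-* y (ι (+ v)))) ⟩
  ι A ℚ.- y ℚ.* ι (+ v)                     ≡⟨ cong₂ (λ a b → ι a ℚ.- b) A≡ yv ⟩
  ι (M * q + B) ℚ.- ι B                     ≡⟨ cong (ℚ._- ι B) (ι-+ (M * q) B) ⟩
  ι (M * q) ℚ.+ ι B ℚ.- ι B                 ≡⟨ ℚ.+-assoc (ι (M * q)) (ι B) (ℚ.- ι B) ⟩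
  ι (M * q) ℚ.+ (ι B ℚ.- ι B)               ≡⟨ cong (ι (M * q) ℚ.+_) (ℚ.+-inverseʳ (ι B)) ⟩
  ι (M * q) ℚ.+ ℚ.0ℚ                        ≡⟨ ℚ.+-identityʳ (ι (M * q)) ⟩
  ι (M * q)                                 ≡⟨ ι-* M q ⟩
  ι M ℚ.* ι q                               ∎)
  where
  open ≡-Reasoning
  A≡ : A ≡ M * q + B
  A≡ = trans (restore A B) (cong (_+ B) (trans e (*-comm q M)))
    where
    restore : ∀ A B → A ≡ A - B + B
    restore A B = solve (A ∷ B ∷ [])

-- Oddness of the prime and the conclusion

halves : ∀ k → k ≡ ℕ.⌊ k /2⌋ ℕ.+ ℕ.⌊ k /2⌋ ⊎ k ≡ suc (ℕ.⌊ k /2⌋ ℕ.+ ℕ.⌊ k /2⌋)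
halves zero          = inj₁ refl
halves (suc zero)    = inj₂ refl
halves (suc (suc k)) with halves k
... | inj₁ e = inj₁ (cong suc (trans (cong suc e) (sym (ℕ.+-suc _ _))))
... | inj₂ e = inj₂ (cong (λ n → suc (suc n)) (trans e (sym (ℕ.+-suc _ _))))

-- For odd k, 3 + k would equal 2 (2 + h) with h = ⌊k/2⌋, and by Euclid's lemma it would divide one
-- of two smaller positive numbers.
odd-prime : ∀ k → Prime (3 ℕ.+ k) → 3 ℕ.+ k ≡ suc (suc ℕ.⌊ k /2⌋ ℕ.+ suc ℕ.⌊ k /2⌋)
odd-prime k p-prime with halves k
... | inj₁ e = cong (λ n → suc (suc n)) (trans (cong suc e) (sym (ℕ.+-suc _ _)))
... | inj₂ e with euclidsLemma 2 (2 ℕ.+ ℕ.⌊ k /2⌋) p-prime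
    (divides 1 (trans (double ℕ.⌊ k /2⌋) (trans (cong (3 ℕ.+_) (sym e)) (sym (ℕ.*-identityˡ _)))))
  where
  double : ∀ h → 2 ℕ.* (2 ℕ.+ h) ≡ 3 ℕ.+ suc (h ℕ.+ h)
  double h = ℕ-Solver.solve (h ∷ [])
... | inj₁ d = ⊥-elim (ℕ.<⇒≱ (s≤s (s≤s (s≤s z≤n))) (∣⇒≤ d))
... | inj₂ d = ⊥-elim (ℕ.<⇒≱ (s≤s (s≤s (s≤s (ℕ.⌊n/2⌋≤n k)))) (∣⇒≤ d))

theorem1p1 : (p : ℕ) → Prime p → 3 ℕ.< p → Congℚ p (+ (p ℕ.^ 4)) (lhs p) (rhs p)
theorem1p1 zero                ()
theorem1p1 (suc zero)          _ (s≤s ())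
theorem1p1 (suc (suc zero))    _ (s≤s (s≤s ()))
theorem1p1 (suc (suc (suc k))) p-prime (s≤s (s≤s (s≤s 0<k))) =
  ≈⇒Congℚ (lhs p) (rhs p) (4 ℕ.* 512 ℕ.^ m) p∤v left right
    (subst (λ M → + 4 * scaledSum m ≈ B [ M ]) (sym modulus) integerCongruence)
  where
  open PrimeField k p-prime
  open Assembly k p-prime 0<k ℕ.⌊ k /2⌋ (odd-prime k p-prime) hiding (s; u; N; f)
  -- The upper limit ⌊(p-1)/2⌋ in `lhs` reduces to this expression.
  m = suc ℕ.⌊ k /2⌋
  E₂ = legendre (- + 2) p
  B = (+ 512) ^ m * (+ 4 * (T * E₂) + T * T * T * ℓ * euler k)
  v≡ : + (4 ℕ.* 512 ℕ.^ m) ≡ + 4 * (+ 512) ^ m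
  v≡ = trans (pos-* 4 (512 ℕ.^ m)) (cong (+ 4 *_) (pos-^ 512 m))
  modulus : + (p ℕ.^ 4) ≡ T * (T * T * T)
  modulus = trans (pos-^ p 4) (regroup T)
    where
    regroup : ∀ T → T * (T * (T * (T * + 1))) ≡ T * (T * T * T)
    regroup T = solve (T ∷ [])
  cube : + (p ℕ.^ 3) ≡ T * T * T
  cube = trans (pos-^ p 3) (regroup T)
    where
    regroup : ∀ T → T * (T * (T * + 1)) ≡ T * T * T
    regroup T = solve (T ∷ [])
  ^≉0 : ∀ x n → ¬ x ≈ + 0 [ T ] → ¬ x ^ n ≈ + 0 [ T ]
  ^≉0 x zero    x≉0 h = small≉0 (s≤s (s≤s z≤n)) h
  ^≉0 x (suc n) x≉0 h = [ x≉0 , ^≉0 x n x≉0 ]′ (euclid x (x ^ n) h)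
  p∤v : ¬ (p ∣ 4 ℕ.* 512 ℕ.^ m)
  -- 4 and 512 are read as 2^2 and 2^9, so it suffices that p does not divide 2.
  p∤v d = [ ^≉0 (+ 2) 2 2≉0 , ^≉0 (+ 512) m (^≉0 (+ 2) 9 2≉0) ]′
    (euclid (+ 4) ((+ 512) ^ m) (≈-trans (≈-reflexive (sym v≡)) (∣⇒≈0 {+ (4 ℕ.* 512 ℕ.^ m)} d)))
  left : lhs p ℚ.* ι (+ (4 ℕ.* 512 ℕ.^ m)) ≡ ι (+ 4 * scaledSum m)
  left = begin
    lhs p ℚ.* ι (+ (4 ℕ.* 512 ℕ.^ m))            ≡⟨ cong (λ z → lhs p ℚ.* ι z) (trans v≡ (*-comm (+ 4) ((+ 512) ^ m))) ⟩
    lhs p ℚ.* ι ((+ 512) ^ m * + 4)              ≡⟨ cong (lhs p ℚ.*_) (ι-* ((+ 512) ^ m) (+ 4)) ⟩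
    lhs p ℚ.* (ι ((+ 512) ^ m) ℚ.* ι (+ 4))      ≡⟨ ℚ.*-assoc (lhs p) (ι ((+ 512) ^ m)) (ι (+ 4)) ⟨
    lhs p ℚ.* ι ((+ 512) ^ m) ℚ.* ι (+ 4)        ≡⟨ cong (ℚ._* ι (+ 4)) (sum-ι m) ⟩
    ι (scaledSum m) ℚ.* ι (+ 4)                  ≡⟨ ι-* (scaledSum m) (+ 4) ⟨
    ι (scaledSum m * + 4)                        ≡⟨ cong ι (*-comm (scaledSum m) (+ 4)) ⟩
    ι (+ 4 * scaledSum m)                        ∎
    where open ≡-Reasoning
  right : rhs p ℚ.* ι (+ (4 ℕ.* 512 ℕ.^ m)) ≡ ι B
  right = begin
    rhs p ℚ.* ι (+ (4 ℕ.* 512 ℕ.^ m))            ≡⟨ cong (λ z → rhs p ℚ.* ι z) v≡ ⟩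
    rhs p ℚ.* ι (+ 4 * (+ 512) ^ m)              ≡⟨ cong (rhs p ℚ.*_) (ι-* (+ 4) ((+ 512) ^ m)) ⟩
    rhs p ℚ.* (ι (+ 4) ℚ.* ι ((+ 512) ^ m))      ≡⟨ ℚ.*-assoc (rhs p) (ι (+ 4)) (ι ((+ 512) ^ m)) ⟨
    rhs p ℚ.* ι (+ 4) ℚ.* ι ((+ 512) ^ m)        ≡⟨ cong (ℚ._* ι ((+ 512) ^ m)) quadruple ⟩
    ι (T * E₂ * + 4 + + (p ℕ.^ 3) * ℓ * euler k) ℚ.* ι ((+ 512) ^ m)
      ≡⟨ ι-* (T * E₂ * + 4 + + (p ℕ.^ 3) * ℓ * euler k) ((+ 512) ^ m) ⟨
    ι ((T * E₂ * + 4 + + (p ℕ.^ 3) * ℓ * euler k) * (+ 512) ^ m)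
      ≡⟨ cong ι (trans (*-comm _ ((+ 512) ^ m)) (cong ((+ 512) ^ m *_)
           (cong₂ _+_ (*-comm (T * E₂) (+ 4)) (cong (λ z → z * ℓ * euler k) cube)))) ⟩
    ι B                                          ∎
    where
    open ≡-Reasoning
    quadruple : rhs p ℚ.* ι (+ 4) ≡ ι (T * E₂ * + 4 + + (p ℕ.^ 3) * ℓ * euler k)
    quadruple = begin
      rhs p ℚ.* ι (+ 4)
        ≡⟨ ℚ.*-distribʳ-+ (ι (+ 4)) (ι (T * E₂)) ((+ (p ℕ.^ 3) * ℓ * euler k) ℚ./ 4) ⟩
      ι (T * E₂) ℚ.* ι (+ 4) ℚ.+ (+ (p ℕ.^ 3) * ℓ * euler k) ℚ./ 4 ℚ.* ι (+ 4)
        ≡⟨ cong₂ ℚ._+_ (sym (ι-* (T * E₂) (+ 4))) (/-ι (+ (p ℕ.^ 3) * ℓ * euler k) 4) ⟩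
      ι (T * E₂ * + 4) ℚ.+ ι (+ (p ℕ.^ 3) * ℓ * euler k)
        ≡⟨ ι-+ (T * E₂ * + 4) (+ (p ℕ.^ 3) * ℓ * euler k) ⟨
      ι (T * E₂ * + 4 + + (p ℕ.^ 3) * ℓ * euler k) ∎
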